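{- Let $d \ge 3$ be an integer, and let $m$ be a product of $r \ge 2$ distinct primes. Then every symmetric Boolean function on $n$ bits can be computed by a depth-$d$ $\text{MOD}_m$ circuit of size $\exp(\tilde{O}(n^{1/(r+d-3)}))$.
   Context: A Boolean function $f:\{0,1\}^n\to\{0,1\}$ is symmetric if $f(\mathbf{x})$ depends only on the number of ones in $\mathbf{x}$. A $\text{MOD}_m$ gate has unbounded fan-in and outputs $1$ iff the sum of its Boolean inputs (counted with multiplicity of wires) is divisible by $m$. A $\text{MOD}_m$ circuit is a circuit all of whose gates are $\text{MOD}_{m'}$ gates with $m' \mid m$ (equivalently, up to wire multiplicities, $\text{MOD}_m$ gates) over the input variables (and constants). Size is the number of gates. $\tilde{O}(\cdot)$ hides polylogarithmic factors in $n$; constants may depend on $d$ and $m$, with $n\to\infty$. -}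

module Defs where

open import Data.Nat using (ℕ; zero; suc; _+_; _*_; _∸_; _^_; _≤_; _⊔_)
open import Data.Nat.Divisibility using (_∣_; _∣?_)
open import Data.Nat.Primality using (Prime)
open import Data.Bool using (Bool; true; false)
open import Data.Fin using (Fin)
open import Data.Vec using (Vec; []; _∷_; lookup; _∷ʳ_)
open import Data.List using (List; length)
open import Data.Nat.ListAction using (product)
open import Data.List.Relation.Unary.All using (All)
open import Data.List.Relation.Unary.Unique.Propositional using (Unique)
open import Data.Product using (Σ; _×_)
open import Relation.Binary.PropositionalEquality using (_≡_)
open import Relation.Nullary using (does)

ones : ∀ {n} → Vec Bool n → ℕ
ones []            = 0
ones (true  ∷ xs)  = suc (ones xs)
ones (false ∷ xs)  = ones xs

Symmetric : ∀ {n} → (Vec Bool n → Bool) → Set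
Symmetric {n} f = ∀ (x y : Vec Bool n) → ones x ≡ ones y → f x ≡ f y

ProductOfDistinctPrimes : ℕ → ℕ → Set
ProductOfDistinctPrimes r m =
  Σ (List ℕ) λ ps → length ps ≡ r × All Prime ps × Unique ps × product ps ≡ m

-- A wire feeding a gate: an input variable, the constant 1 (constant 0
-- contributes nothing to the sum and is thus omitted), or an earlier gate.
data Source (n k : ℕ) : Set where
  input : Fin n → Source n k
  one   : Source n k
  gate  : Fin k → Source n k

record Gate (m n k : ℕ) : Set where
  constructor modGate
  field
    modulus  : ℕ
    modDivm  : modulus ∣ m
    wires    : List (Source n k)

-- A MOD_m circuit on n inputs with k gates, given as a DAG in topological order
-- (each gate may only read inputs, constants and earlier gates).
data Circuit (m n : ℕ) : ℕ → Set where
  []  : Circuit m n 0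
  _▷_ : ∀ {k} → Circuit m n k → Gate m n k → Circuit m n (suc k)

bit : Bool → ℕ
bit true  = 1
bit false = 0

wireSum : ∀ {n k} → Vec Bool n → Vec Bool k → List (Source n k) → ℕ
wireSum x g List.[]              = 0
wireSum x g (input i List.∷ ws)  = bit (lookup x i) + wireSum x g ws
wireSum x g (one     List.∷ ws)  = 1 + wireSum x g ws
wireSum x g (gate j  List.∷ ws)  = bit (lookup g j) + wireSum x g ws

evalAll : ∀ {m n k} → Circuit m n k → Vec Bool n → Vec Bool k
evalAll []                          x = []
evalAll (C ▷ modGate q _ ws) x =
  let g = evalAll C x in g ∷ʳ does (q ∣? wireSum x g ws)

srcDepth : ∀ {n k} → Vec ℕ k → Source n k → ℕ
srcDepth ds (input _) = 0
srcDepth ds one       = 0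
srcDepth ds (gate j)  = lookup ds j

maxDepth : ∀ {n k} → Vec ℕ k → List (Source n k) → ℕ
maxDepth ds List.[]        = 0
maxDepth ds (w List.∷ ws)  = srcDepth ds w ⊔ maxDepth ds ws

depths : ∀ {m n k} → Circuit m n k → Vec ℕ k
depths []                    = []
depths (C ▷ modGate _ _ ws) =
  let ds = depths C in ds ∷ʳ suc (maxDepth ds ws)

last : ∀ {A : Set} {k} → Vec A (suc k) → A
last {k = zero}  (a ∷ []) = a
last {k = suc k} (a ∷ as) = last as

output : ∀ {m n k} → Circuit m n (suc k) → Vec Bool n → Bool
output C x = last (evalAll C x)

depth : ∀ {m n k} → Circuit m n (suc k) → ℕ
depth C = last (depths C)

Computes : ∀ {m n k} → Circuit m n (suc k) → (Vec Bool n → Bool) → Set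
Computes {n = n} C f = ∀ (x : Vec Bool n) → output C x ≡ f x

{-# OPTIONS --safe #-}

-- Let p ≠ q be primes dividing m. Modulo p, the product of a bit with a MOD_q gate is
-- a linear combination of p (q + p) MOD_q gates, so the class of functions that are sums
-- modulo p of MOD_q gates is closed under multiplication by s bits at the cost of a
-- factor exp (O (s)).
--
-- Depth 2, inputs of length at most s ^ r: for a power P of p just above s, the P-th
-- difference of the P-periodic indicator of N ≡ c (mod P) vanishes modulo p, so this
-- indicator of the number N of ones is a polynomial of degree < P in the inputs, hence a
-- sum modulo p of MOD_q gates. By the Chinese remainder theorem one MOD_m gate on top
-- tests the congruences for all r primes at once and thereby decides N = c.
--
-- Each further factor s in the length costs one level: split the inputs into s blocks
-- and sum, over the possible numbers of ones in the blocks, the products of the s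
-- indicators of these numbers. With s ^ t ≈ n for t = r + d - 3 the size is exp (Õ (s)).
-- The gates are built as formulas (trees), whose unshared size already obeys the bound.

module Submission where

open import Defs
open import Data.Nat
open import Data.Nat.Properties
open import Data.Nat.Combinatorics
  using (nCk+nC[k+1]≡[n+1]C[k+1]; nCn≡1; k>n⇒nCk≡0) renaming (_C_ to _choose_)
open import Data.Nat.Coprimality as Coprimality using (Coprime; coprime-Bézout; coprime-divisor)
open import Data.Nat.Divisibility
open import Data.Nat.DivMod using (_/_; _%_; m≡m%n+[m/n]*n; m%n<n)
open import Data.Nat.GCD using (module Bézout)
open import Data.Nat.ListAction using (product)
open import Data.Nat.Logarithm using (⌊log₂_⌋; ⌊log₂⌋-mono-≤; ⌊log₂[2^n]⌋≡n)
open import Data.Nat.Primality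
open import Data.Nat.Tactic.RingSolver using (solve-∀)
open import Data.Bool using (Bool; true; false; not)
open import Data.Fin using (Fin; zero; suc; fromℕ; inject₁)
open import Data.List using (List; []; _∷_; _++_; length; map; take; drop; tabulate; allFin)
open import Data.List.Properties
  using (length-++; length-map; length-take; length-drop; length-tabulate; take++drop≡id)
open import Data.List.Relation.Unary.All using (All; []; _∷_)
import Data.List.Relation.Unary.All as All
import Data.List.Relation.Unary.All.Properties as All
open import Data.List.Relation.Unary.AllPairs using (AllPairs; []; _∷_)
open import Data.List.Relation.Unary.Unique.Propositional using (Unique)
open import Data.Product using (Σ; ∃; _×_; _,_; proj₁; proj₂)
open import Data.Sum using (inj₁; inj₂)
open import Data.Vec using (Vec; []; _∷_; lookup; _∷ʳ_)
open import Function using (_∘_)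
open import Relation.Binary.Bundles using (Setoid)
open import Relation.Binary.PropositionalEquality
import Relation.Binary.Reasoning.Setoid as SetoidReasoning
open import Relation.Nullary using (¬_; Dec; does; yes; no; contradiction)
open import Relation.Nullary.Decidable using (dec-true; dec-false)

-- Congruence of natural numbers

infix 4 _≈_[mod_]

-- Both sides are moved up, so that congruences of naturals need no subtraction.
record _≈_[mod_] (a b p : ℕ) : Set where
  constructor shift
  field
    u v : ℕ
    eq  : a + u * p ≡ b + v * p

module _ {p : ℕ} where

  ≈-reflexive : ∀ {a b} → a ≡ b → a ≈ b [mod p ]
  ≈-reflexive refl = shift 0 0 refl

  ≈-refl : ∀ {a} → a ≈ a [mod p ]
  ≈-refl = ≈-reflexive refl

  ≈-sym : ∀ {a b} → a ≈ b [mod p ] → b ≈ a [mod p ]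
  ≈-sym (shift u v eq) = shift v u (sym eq)

  ≈-trans : ∀ {a b c} → a ≈ b [mod p ] → b ≈ c [mod p ] → a ≈ c [mod p ]
  ≈-trans {a} {b} {c} (shift u v eq) (shift u′ v′ eq′) = shift (u + u′) (v + v′) (begin
    a + (u + u′) * p     ≡⟨ lemma a u u′ p ⟩
    (a + u * p) + u′ * p ≡⟨ cong (_+ u′ * p) eq ⟩
    (b + v * p) + u′ * p ≡⟨ swap b v u′ p ⟩
    (b + u′ * p) + v * p ≡⟨ cong (_+ v * p) eq′ ⟩
    (c + v′ * p) + v * p ≡⟨ unlemma c v v′ p ⟩
    c + (v + v′) * p     ∎)
    where
    open ≡-Reasoning
    lemma : ∀ a u u′ p → a + (u + u′) * p ≡ (a + u * p) + u′ * p
    lemma = solve-∀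
    swap : ∀ b v u′ p → (b + v * p) + u′ * p ≡ (b + u′ * p) + v * p
    swap = solve-∀
    unlemma : ∀ c v v′ p → (c + v′ * p) + v * p ≡ c + (v + v′) * p
    unlemma = solve-∀

  +-cong-≈ : ∀ {a b c d} → a ≈ b [mod p ] → c ≈ d [mod p ] → a + c ≈ b + d [mod p ]
  +-cong-≈ {a} {b} {c} {d} (shift u v eq) (shift u′ v′ eq′) =
    shift (u + u′) (v + v′)
      (trans (lemma a c u u′ p) (trans (cong₂ _+_ eq eq′) (sym (lemma b d v v′ p))))
    where
    lemma : ∀ a c u u′ p → (a + c) + (u + u′) * p ≡ (a + u * p) + (c + u′ * p)
    lemma = solve-∀

  *-congˡ-≈ : ∀ c {a b} → a ≈ b [mod p ] → c * a ≈ c * b [mod p ]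
  *-congˡ-≈ c {a} {b} (shift u v eq) = shift (c * u) (c * v)
    (trans (lemma c a u p) (trans (cong (c *_) eq) (sym (lemma c b v p))))
    where
    lemma : ∀ c a u p → c * a + c * u * p ≡ c * (a + u * p)
    lemma = solve-∀

  *-congʳ-≈ : ∀ c {a b} → a ≈ b [mod p ] → a * c ≈ b * c [mod p ]
  *-congʳ-≈ c {a} {b} a≈b rewrite *-comm a c | *-comm b c = *-congˡ-≈ c a≈b

  ∣-resp-≈ : ∀ {a b} → a ≈ b [mod p ] → p ∣ a → p ∣ b
  ∣-resp-≈ {a} {b} (shift u v eq) p∣a = ∣m+n∣m⇒∣n
    (subst (p ∣_) (trans eq (+-comm b _)) (∣m∣n⇒∣m+n p∣a (n∣m*n u))) (n∣m*n v)

  ∣⇒≈0 : ∀ {a} → p ∣ a → a ≈ 0 [mod p ]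
  ∣⇒≈0 (divides k eq) = shift 0 k (trans (+-identityʳ _) eq)

  ≈0⇒∣ : ∀ {a} → a ≈ 0 [mod p ] → p ∣ a
  ≈0⇒∣ a≈0 = ∣-resp-≈ (≈-sym a≈0) (p ∣0)

  +-multiple-≈ : ∀ k a → a + k * p ≈ a [mod p ]
  +-multiple-≈ k a = shift 0 k (+-identityʳ _)

  +-cancelʳ-≈ : ∀ c {a b} → a + c ≈ b + c [mod p ] → a ≈ b [mod p ]
  +-cancelʳ-≈ c {a} {b} (shift u v eq) = shift u v
    (+-cancelʳ-≡ c _ _ (trans (lemma a c u p) (trans eq (sym (lemma b c v p)))))
    where
    lemma : ∀ a c u p → a + u * p + c ≡ a + c + u * p
    lemma = solve-∀

  ≈⇒∣distance : ∀ {a b} → a ≈ b [mod p ] → p ∣ ∣ a - b ∣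
  ≈⇒∣distance {a} {b} a≈b with ≤-total a b
  ... | inj₁ a≤b = subst (p ∣_) (sym (m≤n⇒∣m-n∣≡n∸m a≤b)) (≈0⇒∣ (+-cancelʳ-≈ a
        (subst (_≈ a [mod p ]) (sym (m∸n+n≡m a≤b)) (≈-sym a≈b))))
  ... | inj₂ b≤a = subst (p ∣_) (sym (m≤n⇒∣n-m∣≡n∸m b≤a)) (≈0⇒∣ (+-cancelʳ-≈ b
        (subst (_≈ b [mod p ]) (sym (m∸n+n≡m b≤a)) a≈b)))

≈-setoid : ℕ → Setoid _ _
≈-setoid p = record
  { Carrier = ℕ ; _≈_ = λ a b → a ≈ b [mod p ]
  ; isEquivalence = record { refl = ≈-refl ; sym = ≈-sym ; trans = ≈-trans } }

module ≈-Reasoning (p : ℕ) = SetoidReasoning (≈-setoid p)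

-- Residues and inverses modulo a prime

prime>1 : ∀ {p} → Prime p → 1 < p
prime>1 {p} pr = nonTrivial⇒n>1 p
  where instance _ = prime⇒nonTrivial pr

1+[p∸1]≡p : ∀ {p} → Prime p → suc (p ∸ 1) ≡ p
1+[p∸1]≡p pr = m+[n∸m]≡n (<⇒≤ (prime>1 pr))

-- Multiplication by a scalar is realised by repeating gates, so scalars are first reduced to keep
-- the number of copies at most p.
residue : ∀ {p} → Prime p → ∀ a → ∃ λ c → c ≤ p × c ≈ a [mod p ]
residue {p} pr a = a % p , <⇒≤ (m%n<n a p) , shift (a / p) 0
  (trans (sym (m≡m%n+[m/n]*n a p)) (sym (+-identityʳ a)))
  where instance _ = prime⇒nonZero pr

prime∤⇒coprime : ∀ {p n} → Prime p → ¬ p ∣ n → Coprime p n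
prime∤⇒coprime pr p∤n (d∣p , d∣n) with prime⇒irreducible pr d∣p
... | inj₁ d≡1  = d≡1
... | inj₂ refl = contradiction d∣n p∤n

prime≢⇒coprime : ∀ {p q} → Prime p → Prime q → p ≢ q → Coprime p q
prime≢⇒coprime {p} {q} pp pq p≢q = prime∤⇒coprime pp p∤q
  where
  p∤q : ¬ p ∣ q
  p∤q p∣q with prime⇒irreducible pq p∣q
  ... | inj₁ refl = ¬prime[1] pp
  ... | inj₂ p≡q  = p≢q p≡q

inverse : ∀ {p q} → Prime p → Coprime p q → ∃ λ c → c ≤ p × c * q ≈ 1 [mod p ]
inverse {p} {q} pr coprime = reduced (unreduced (coprime-Bézout coprime))
  where
  unreduced : Bézout.Identity 1 p q → ∃ λ c → c * q ≈ 1 [mod p ]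
  unreduced (Bézout.-+ x y eq) = y , shift 0 x (trans (+-identityʳ _) (sym eq))
  -- Here y q ≈ -1, so that (y q)² ≈ 1.
  unreduced (Bézout.+- x y eq) = y * (y * q) , shift x (y * q * x)
    (trans (cong (y * (y * q) * q +_) (sym eq))
    (trans (lemma₁ y q) (trans (cong (λ z → 1 + y * q * z) eq) (lemma₂ y q x p))))
    where
    lemma₁ : ∀ y q → y * (y * q) * q + (1 + y * q) ≡ 1 + y * q * (1 + y * q)
    lemma₁ = solve-∀
    lemma₂ : ∀ y q x p → 1 + y * q * (x * p) ≡ 1 + y * q * x * p
    lemma₂ = solve-∀
  reduced : (∃ λ c → c * q ≈ 1 [mod p ]) → ∃ λ c → c ≤ p × c * q ≈ 1 [mod p ]
  reduced (c , cq≈1) with residue pr c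
  ... | c′ , c′≤p , c′≈c = c′ , c′≤p , ≈-trans (*-congʳ-≈ q c′≈c) cq≈1

-- Finite sums

sumTo : ℕ → (ℕ → ℕ) → ℕ
sumTo zero    f = 0
sumTo (suc k) f = f 0 + sumTo k (f ∘ suc)

sumTo-cong : ∀ k {f g} → (∀ i → f i ≡ g i) → sumTo k f ≡ sumTo k g
sumTo-cong zero    f≗g = refl
sumTo-cong (suc k) f≗g = cong₂ _+_ (f≗g 0) (sumTo-cong k (f≗g ∘ suc))

sumTo-+ : ∀ k f g → sumTo k (λ i → f i + g i) ≡ sumTo k f + sumTo k g
sumTo-+ zero    f g = refl
sumTo-+ (suc k) f g rewrite sumTo-+ k (f ∘ suc) (g ∘ suc) =
  lemma (f 0) (g 0) (sumTo k (f ∘ suc)) (sumTo k (g ∘ suc))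
  where
  lemma : ∀ a b c d → a + b + (c + d) ≡ a + c + (b + d)
  lemma = solve-∀

sumTo-last : ∀ k f → sumTo (suc k) f ≡ sumTo k f + f k
sumTo-last zero    f = +-identityʳ (f 0)
sumTo-last (suc k) f = trans (cong (f 0 +_) (sumTo-last k (f ∘ suc))) (sym (+-assoc (f 0) _ _))

sumTo-≈ : ∀ {p} k {f g} → (∀ i → i < k → f i ≈ g i [mod p ]) → sumTo k f ≈ sumTo k g [mod p ]
sumTo-≈ zero    f≈g = ≈-refl
sumTo-≈ (suc k) f≈g = +-cong-≈ (f≈g 0 z<s) (sumTo-≈ k λ i i<k → f≈g (suc i) (s<s i<k))

sumTo-0 : ∀ k → sumTo k (λ _ → 0) ≡ 0
sumTo-0 zero    = refl
sumTo-0 (suc k) = sumTo-0 k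

sumTo-select : ∀ {k n} → n < k → (h : ℕ → ℕ) → sumTo k (λ c → bit (n ≡ᵇ c) * h c) ≡ h n
sumTo-select {suc k} {zero}  _         h = trans
  (cong₂ _+_ (+-identityʳ (h 0)) (sumTo-0 k)) (+-identityʳ (h 0))
sumTo-select {suc k} {suc n} (s≤s n<k) h = sumTo-select n<k (h ∘ suc)

-- Finite differences

-- For a = p - 1, which stands for -1 modulo p, this is the difference g n - g (n + 1).
Δ : ℕ → (ℕ → ℕ) → ℕ → ℕ
Δ a g n = g n + a * g (suc n)

Δ^ : ℕ → ℕ → (ℕ → ℕ) → ℕ → ℕ
Δ^ a zero    g = g
Δ^ a (suc k) g = Δ^ a k (Δ a g)

binomialSum : ℕ → (ℕ → ℕ) → ℕ
binomialSum k f = sumTo (suc k) (λ j → (k choose j) * f j)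

-- Pascal's rule in summed form: with E the shift of f, it says (1 + E)^(k+1) = (1 + E)^k + (1 +
-- E)^k E. The surplus last term of the second sum has the coefficient C(k, k+1) = 0.
binomialSum-suc : ∀ k f → binomialSum (suc k) f ≡ binomialSum k f + binomialSum k (f ∘ suc)
binomialSum-suc k f = begin
  1 * f 0 + sumTo (suc k) (λ j → (suc k choose suc j) * f (suc j))
    ≡⟨ cong (1 * f 0 +_) (sumTo-cong (suc k) pascal) ⟩
  1 * f 0 + sumTo (suc k) (λ j → (k choose j) * f (suc j) + (k choose suc j) * f (suc j))
    ≡⟨ cong (1 * f 0 +_) (sumTo-+ (suc k) (λ j → (k choose j) * f (suc j)) (λ j → (k choose suc j) * f (suc j))) ⟩
  1 * f 0 + (binomialSum k (f ∘ suc) + sumTo (suc k) (λ j → (k choose suc j) * f (suc j)))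
    ≡⟨ cong (λ z → 1 * f 0 + (binomialSum k (f ∘ suc) + z)) dropLast ⟩
  1 * f 0 + (binomialSum k (f ∘ suc) + sumTo k (λ j → (k choose suc j) * f (suc j)))
    ≡⟨ lemma (1 * f 0) (binomialSum k (f ∘ suc)) _ ⟩
  binomialSum k f + binomialSum k (f ∘ suc) ∎
  where
  open ≡-Reasoning
  pascal : ∀ j → (suc k choose suc j) * f (suc j) ≡ (k choose j) * f (suc j) + (k choose suc j) * f (suc j)
  pascal j = trans (cong (_* f (suc j)) (sym (nCk+nC[k+1]≡[n+1]C[k+1] k j)))
    (*-distribʳ-+ (f (suc j)) (k choose j) (k choose suc j))
  dropLast : sumTo (suc k) (λ j → (k choose suc j) * f (suc j)) ≡ sumTo k (λ j → (k choose suc j) * f (suc j))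
  dropLast = trans (sumTo-last k _) (trans
    (cong (λ z → sumTo k (λ j → (k choose suc j) * f (suc j)) + z * f (suc k)) (k>n⇒nCk≡0 (n<1+n k)))
    (+-identityʳ _))
  lemma : ∀ a b c → a + (b + c) ≡ a + c + b
  lemma = solve-∀

-- As an operator, `Δ a` is 1 + a E with E the shift, so its powers expand by the binomial theorem.
Δ^-binomialSum : ∀ a k g n → Δ^ a k g n ≡ binomialSum k (λ j → a ^ j * g (n + j))
Δ^-binomialSum a zero    g n = sym (trans (+-identityʳ _) (trans (+-identityʳ _)
  (trans (+-identityʳ _) (cong g (+-identityʳ n)))))
Δ^-binomialSum a (suc k) g n = begin
  Δ^ a k (Δ a g) n
    ≡⟨ Δ^-binomialSum a k (Δ a g) n ⟩
  binomialSum k (λ j → a ^ j * Δ a g (n + j))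
    ≡⟨ sumTo-cong (suc k) expand ⟩
  sumTo (suc k) (λ j → (k choose j) * f j + (k choose j) * f (suc j))
    ≡⟨ sumTo-+ (suc k) (λ j → (k choose j) * f j) (λ j → (k choose j) * f (suc j)) ⟩
  binomialSum k f + binomialSum k (f ∘ suc)
    ≡⟨ binomialSum-suc k f ⟨
  binomialSum (suc k) f ∎
  where
  open ≡-Reasoning
  f : ℕ → ℕ
  f j = a ^ j * g (n + j)
  lemma : ∀ c b a x y → c * (b * (x + a * y)) ≡ c * (b * x) + c * (a * b * y)
  lemma = solve-∀
  expand : ∀ j → (k choose j) * (a ^ j * Δ a g (n + j)) ≡ (k choose j) * f j + (k choose j) * f (suc j)
  expand j = trans (lemma (k choose j) (a ^ j) a (g (n + j)) (g (suc (n + j))))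
    (cong (λ z → (k choose j) * f j + (k choose j) * (a ^ suc j * g z)) (sym (+-suc n j)))

-- Binomial coefficients of prime powers

absorption : ∀ n k → suc k * (suc n choose suc k) ≡ suc n * (n choose k)
absorption zero    zero    = refl
absorption zero    (suc k) = trans
  (cong (suc (suc k) *_) (k>n⇒nCk≡0 {1} {suc (suc k)} (s<s z<s)))
  (trans (*-zeroʳ (suc (suc k))) (cong (1 *_) (sym (k>n⇒nCk≡0 {0} {suc k} z<s))))
absorption (suc n) k = begin
  suc k * (suc (suc n) choose suc k)
    ≡⟨ cong (suc k *_) (nCk+nC[k+1]≡[n+1]C[k+1] (suc n) k) ⟨
  suc k * ((suc n choose k) + (suc n choose suc k))
    ≡⟨ *-distribˡ-+ (suc k) (suc n choose k) _ ⟩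
  suc k * (suc n choose k) + suc k * (suc n choose suc k)
    ≡⟨ cong (suc k * (suc n choose k) +_) (absorption n k) ⟩
  suc k * (suc n choose k) + suc n * (n choose k)
    ≡⟨ rest k ⟩
  suc (suc n) * (suc n choose k) ∎
  where
  open ≡-Reasoning
  lemma : ∀ k c n d → suc k * c + suc n * d ≡ c + (k * c + suc n * d)
  lemma = solve-∀
  rest : ∀ k → suc k * (suc n choose k) + suc n * (n choose k) ≡ suc (suc n) * (suc n choose k)
  rest zero    = lemma 0 1 n 1
  rest (suc k) = begin
    suc (suc k) * (suc n choose suc k) + suc n * (n choose suc k)
      ≡⟨ lemma (suc k) (suc n choose suc k) n (n choose suc k) ⟩
    (suc n choose suc k) + (suc k * (suc n choose suc k) + suc n * (n choose suc k))
      ≡⟨ cong (λ z → (suc n choose suc k) + (z + suc n * (n choose suc k))) (absorption n k) ⟩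
    (suc n choose suc k) + (suc n * (n choose k) + suc n * (n choose suc k))
      ≡⟨ cong ((suc n choose suc k) +_) (*-distribˡ-+ (suc n) (n choose k) (n choose suc k)) ⟨
    (suc n choose suc k) + suc n * ((n choose k) + (n choose suc k))
      ≡⟨ cong (λ z → (suc n choose suc k) + suc n * z) (nCk+nC[k+1]≡[n+1]C[k+1] n k) ⟩
    suc (suc n) * (suc n choose suc k) ∎

coprime-* : ∀ {a b c} → Coprime a c → Coprime b c → Coprime (a * b) c
coprime-* {a} {b} {c} a⊥c b⊥c {d} (d∣ab , d∣c) = b⊥c (coprime-divisor d⊥a d∣ab , d∣c)
  where
  d⊥a : Coprime d a
  d⊥a (e∣d , e∣a) = a⊥c (e∣a , ∣-trans e∣d d∣c)

coprime-^ : ∀ {a c} e → Coprime a c → Coprime (a ^ e) c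
coprime-^         zero    a⊥c = Coprimality.1-coprimeTo _
coprime-^ {a} {c} (suc e) a⊥c = coprime-* {a} {a ^ e} {c} a⊥c (coprime-^ e a⊥c)

-- By `absorption`, p ^ e divides the product of the binomial coefficient and its lower index. If p
-- did not divide the coefficient, p ^ e would be coprime to it and hence divide the lower index,
-- which is positive and smaller.
prime∣binomial : ∀ {p} → Prime p → ∀ e {j} → 0 < j → j < p ^ e → p ∣ ((p ^ e) choose j)
prime∣binomial {p} pr e {suc j} _ j<q with p ∣? ((p ^ e) choose suc j)
... | yes p∣ = p∣
... | no  p∤ = contradiction j<q (≤⇒≯ (∣⇒≤ q∣j))
  where
  q∣product : p ^ e ∣ ((p ^ e) choose suc j) * suc j
  q∣product with p ^ e
  ... | suc q = subst (suc q ∣_) (trans (sym (absorption q j)) (*-comm (suc j) _)) (m∣m*n (q choose j))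
  q∣j : p ^ e ∣ suc j
  q∣j = coprime-divisor (coprime-^ e (prime∤⇒coprime pr p∤)) q∣product

-- Finite differences modulo p

module _ {p a : ℕ} (1+a≡p : 1 + a ≡ p) where

  Δ^-≈0 : ∀ k {g} → (∀ n → g n ≈ 0 [mod p ]) → ∀ n → Δ^ a k g n ≈ 0 [mod p ]
  Δ^-≈0 zero    g≈0 = g≈0
  Δ^-≈0 (suc k) g≈0 = Δ^-≈0 k λ n → +-cong-≈ (g≈0 n)
    (≈-trans (*-congˡ-≈ a (g≈0 (suc n))) (≈-reflexive (*-zeroʳ a)))

  Δ^-one : ∀ k n → Δ^ a (suc k) (λ _ → 1) n ≈ 0 [mod p ]
  Δ^-one k = Δ^-≈0 k λ n → ∣⇒≈0 (∣-reflexive (trans (sym 1+a≡p) (cong suc (sym (*-identityʳ a)))))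

  module _ (pr : Prime p) (e : ℕ) (1<q : 1 < p ^ e) where

    private q = p ^ e

    -- Modulo p only the two extreme terms of the binomial expansion survive.
    Δ^-extremes : ∀ g n → Δ^ a q g n ≈ g n + a ^ q * g (n + q) [mod p ]
    Δ^-extremes g n = ≈-trans (≈-reflexive (Δ^-binomialSum a q g n)) (extremes q (<-trans z<s 1<q) middle)
      where
      f : ℕ → ℕ
      f j = a ^ j * g (n + j)
      middle : ∀ j → 0 < j → j < q → p ∣ (q choose j)
      middle j = prime∣binomial pr e
      -- The order is generalised from p ^ e to any q with these divisibilities, so that it can be
      -- matched as a successor and the last term split off.
      extremes : ∀ q → 0 < q → (∀ j → 0 < j → j < q → p ∣ (q choose j)) →
        binomialSum q f ≈ g n + a ^ q * g (n + q) [mod p ]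
      extremes (suc q) _ p∣ = begin
        1 * f 0 + sumTo (suc q) h
          ≈⟨ ≈-reflexive (cong (1 * f 0 +_) (sumTo-last q h)) ⟩
        1 * f 0 + (sumTo q h + h q)
          ≈⟨ +-cong-≈ (≈-refl {a = 1 * f 0}) (+-cong-≈ vanish (≈-refl {a = h q})) ⟩
        1 * f 0 + (0 + h q)
          ≈⟨ ≈-reflexive (cong₂ _+_ first final) ⟩
        g n + f (suc q) ∎
        where
        open ≈-Reasoning p
        h : ℕ → ℕ
        h j = (suc q choose suc j) * f (suc j)
        vanish : sumTo q h ≈ 0 [mod p ]
        vanish = ≈-trans
          (sumTo-≈ q λ j j<q → ∣⇒≈0 (∣m⇒∣m*n (f (suc j)) (p∣ (suc j) z<s (s<s j<q))))
          (≈-reflexive (sumTo-0 q))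
        first : 1 * f 0 ≡ g n
        first = trans (*-identityˡ (f 0)) (trans (*-identityˡ _) (cong g (+-identityʳ n)))
        final : h q ≡ f (suc q)
        final = trans (cong (_* f (suc q)) (nCn≡1 (suc q))) (*-identityˡ _)

    -- Since a ^ q ≈ -1, the two surviving terms are g n - g (n + q), which cancel for a q-periodic
    -- g. Hence such a g is a polynomial of degree less than q modulo p.
    Δ^-periodic : ∀ g → (∀ n → g (n + q) ≡ g n) → ∀ n → Δ^ a q g n ≈ 0 [mod p ]
    Δ^-periodic g periodic n = begin
      Δ^ a q g n               ≈⟨ Δ^-extremes g n ⟩
      g n + a ^ q * g (n + q)  ≈⟨ ≈-reflexive (cong (λ z → g n + a ^ q * z) (periodic n)) ⟩
      g n + a ^ q * g n        ≈⟨ *-congʳ-≈ (g n) 1+a^q≈0 ⟩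
      0                        ∎
      where
      open ≈-Reasoning p
      ones≈0 : ∀ q → 1 < q → Δ^ a q (λ _ → 1) 0 ≈ 0 [mod p ]
      ones≈0 (suc q) _ = Δ^-one q 0
      -- The same expansion applied to the constant 1, whose differences vanish, treats p = 2 and
      -- odd p alike.
      1+a^q≈0 : 1 + a ^ q ≈ 0 [mod p ]
      1+a^q≈0 = begin
        1 + a ^ q              ≈⟨ ≈-reflexive (cong suc (*-identityʳ (a ^ q))) ⟨
        1 + a ^ q * 1          ≈⟨ Δ^-extremes (λ _ → 1) 0 ⟨
        Δ^ a q (λ _ → 1) 0     ≈⟨ ones≈0 q 1<q ⟩
        0                      ∎

-- Formulas and their counts modulo p

χ : ℕ → ℕ → ℕ
χ q a = bit (does (q ∣? a))

χ-∣ : ∀ {q a} → q ∣ a → χ q a ≡ 1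
χ-∣ {q} {a} q∣a = cong bit (dec-true (q ∣? a) q∣a)

χ-∤ : ∀ {q a} → ¬ q ∣ a → χ q a ≡ 0
χ-∤ {q} {a} q∤a = cong bit (dec-false (q ∣? a) q∤a)

χ-cong : ∀ {q a b} → a ≈ b [mod q ] → χ q a ≡ χ q b
χ-cong {q} {a} {b} a≈b with q ∣? b
... | yes q∣b = χ-∣ (∣-resp-≈ (≈-sym a≈b) q∣b)
... | no  q∤b = χ-∤ (q∤b ∘ ∣-resp-≈ a≈b)

-- The step v acts as a switch. Over q terms, v = 0 gives q times the indicator of q dividing u,
-- while v = 1 gives 1 whatever u is.
χ-progression : ℕ → ℕ → ℕ → ℕ → ℕ
χ-progression q zero    u v = 0
χ-progression q (suc k) u v = χ q u + χ-progression q k (v + u) v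

χ-progression-cong : ∀ q k {u u′ v v′} → u ≈ u′ [mod q ] → v ≈ v′ [mod q ] →
  χ-progression q k u v ≡ χ-progression q k u′ v′
χ-progression-cong q zero    u≈u′ v≈v′ = refl
χ-progression-cong q (suc k) u≈u′ v≈v′ =
  cong₂ _+_ (χ-cong u≈u′) (χ-progression-cong q k (+-cong-≈ v≈v′ u≈u′) v≈v′)

χ-progression-constant : ∀ q k u → χ-progression q k u 0 ≡ k * χ q u
χ-progression-constant q zero    u = refl
χ-progression-constant q (suc k) u = cong (χ q u +_) (χ-progression-constant q k u)

χ-progression-last : ∀ q k u → χ-progression q (suc k) u 1 ≡ χ-progression q k u 1 + χ q (k + u)
χ-progression-last q zero    u = +-identityʳ _
χ-progression-last q (suc k) u = trans (cong (χ q u +_) (χ-progression-last q k (suc u)))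
  (trans (sym (+-assoc (χ q u) _ _))
    (cong (λ z → χ q u + χ-progression q k (suc u) 1 + χ q z) (+-suc k u)))

χ-progression-none : ∀ q k u → 0 < u → k + u ≤ q → χ-progression q k u 1 ≡ 0
χ-progression-none q zero    u       _ _   = refl
χ-progression-none q (suc k) (suc u) _ k+u≤q = cong₂ _+_
  (χ-∤ {q} {suc u} λ q∣u → contradiction (∣⇒≤ q∣u) (<⇒≱ (≤-trans (s≤s (m≤n+m (suc u) k)) k+u≤q)))
  (χ-progression-none q k (suc (suc u)) z<s (≤-trans (≤-reflexive (+-suc k (suc u))) k+u≤q))

-- Exactly one of q consecutive numbers is a multiple of q. Moving the window by one exchanges u for
-- q + u, which is congruent to it, so it suffices to look at the window starting at 0.
χ-progression-period : ∀ q → 0 < q → ∀ u → χ-progression q q u 1 ≡ 1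
χ-progression-period (suc q) _ zero    = cong₂ _+_ (χ-∣ {suc q} (suc q ∣0))
  (χ-progression-none (suc q) q 1 z<s (≤-reflexive (+-comm q 1)))
χ-progression-period (suc q) _ (suc u) = trans shiftʳ (χ-progression-period (suc q) z<s u)
  where
  shiftʳ : χ-progression (suc q) (suc q) (suc u) 1 ≡ χ-progression (suc q) (suc q) u 1
  shiftʳ = +-cancelˡ-≡ (χ (suc q) u) _ _ (begin
    χ (suc q) u + χ-progression (suc q) (suc q) (suc u) 1
      ≡⟨ χ-progression-last (suc q) (suc q) u ⟩
    χ-progression (suc q) (suc q) u 1 + χ (suc q) (suc q + u)
      ≡⟨ cong (χ-progression (suc q) (suc q) u 1 +_) (χ-cong {suc q} {suc q + u} {u}
           (shift 0 1 (trans (+-identityʳ (suc q + u)) (lemma q u)))) ⟩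
    χ-progression (suc q) (suc q) u 1 + χ (suc q) u
      ≡⟨ +-comm _ (χ (suc q) u) ⟩
    χ (suc q) u + χ-progression (suc q) (suc q) u 1 ∎)
    where
    open ≡-Reasoning
    lemma : ∀ q u → suc q + u ≡ u + 1 * suc q
    lemma = solve-∀

-- Modulo a prime p ≠ q, where q is invertible, this turns the product of a bit y
-- with a MOD_q gate into a sum of MOD_q gates.
χ-progression-bit : ∀ {q} → 1 < q → ∀ y u →
  χ-progression q q u (bit (not y)) + χ q (bit (not y)) ≡ q * (bit y * χ q u) + 1
χ-progression-bit {q} 1<q true  u = cong₂ _+_
  (trans (χ-progression-constant q q u) (cong (q *_) (sym (*-identityˡ (χ q u)))))
  (χ-∣ (q ∣0))
χ-progression-bit {q} 1<q false u = trans
  (cong₂ _+_ (χ-progression-period q (<-trans z<s 1<q) u)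
    (χ-∤ {q} {1} λ q∣1 → contradiction (∣⇒≤ q∣1) (<⇒≱ 1<q)))
  (cong (_+ 1) (sym (*-zeroʳ q)))

-- The index bounds the depth. All inputs of a gate have the same index, so variables feed only
-- gates of the lowest level.
data Formula (m n : ℕ) : ℕ → Set where
  one : ∀ {d} → Formula m n d
  var : Fin n → Formula m n 0
  mod : ∀ {d} q → q ∣ m → List (Formula m n d) → Formula m n (suc d)

module _ {m n : ℕ} where

  mutual
    evaluate : ∀ {d} → Formula m n d → Vec Bool n → Bool
    evaluate one         x = true
    evaluate (var i)     x = lookup x i
    evaluate (mod q _ φs) x = does (q ∣? count φs x)

    count : ∀ {d} → List (Formula m n d) → Vec Bool n → ℕ
    count []       x = 0
    count (φ ∷ φs) x = bit (evaluate φ x) + count φs x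

  mutual
    size : ∀ {d} → Formula m n d → ℕ
    size one          = 0
    size (var _)      = 0
    size (mod _ _ φs) = suc (sizes φs)

    sizes : ∀ {d} → List (Formula m n d) → ℕ
    sizes []       = 0
    sizes (φ ∷ φs) = size φ + sizes φs

  count-++ : ∀ {d} (φs ψs : List (Formula m n d)) x → count (φs ++ ψs) x ≡ count φs x + count ψs x
  count-++ []       ψs x = refl
  count-++ (φ ∷ φs) ψs x = trans (cong (bit (evaluate φ x) +_) (count-++ φs ψs x))
    (sym (+-assoc (bit (evaluate φ x)) _ _))

  sizes-++ : ∀ {d} (φs ψs : List (Formula m n d)) → sizes (φs ++ ψs) ≡ sizes φs + sizes ψs
  sizes-++ []       ψs = refl
  sizes-++ (φ ∷ φs) ψs = trans (cong (size φ +_) (sizes-++ φs ψs)) (sym (+-assoc (size φ) _ _))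

  gateCount : ∀ {d} → ℕ → List (List (Formula m n d)) → Vec Bool n → ℕ
  gateCount q []         x = 0
  gateCount q (φs ∷ φss) x = χ q (count φs x) + gateCount q φss x

  gateCount-++ : ∀ {d} q (φss ψss : List (List (Formula m n d))) x →
    gateCount q (φss ++ ψss) x ≡ gateCount q φss x + gateCount q ψss x
  gateCount-++ q []         ψss x = refl
  gateCount-++ q (φs ∷ φss) ψss x = trans (cong (χ q (count φs x) +_) (gateCount-++ q φss ψss x))
    (sym (+-assoc (χ q (count φs x)) _ _))

-- What a gate with modulus p can see of its inputs: how many of them are true, up to multiples of
-- p.
record CountMod (m n p d S : ℕ) (F : Vec Bool n → ℕ) : Set where
  constructor counting
  field
    formulas : List (Formula m n d)
    correct  : ∀ x → count formulas x ≈ F x [mod p ]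
    bounded  : sizes formulas ≤ S

-- A MOD_q gate is kept as the list of its inputs, because multiplication by a bit
-- adds further inputs to it.
record GateSum (m n p q d W B : ℕ) (F : Vec Bool n → ℕ) : Set where
  constructor summing
  field
    gates   : List (List (Formula m n d))
    correct : ∀ x → gateCount q gates x ≈ F x [mod p ]
    few     : length gates ≤ W
    small   : All (λ φs → sizes φs ≤ B) gates

module _ {m n p d : ℕ} where

  private CM = CountMod m n p d

  CountMod-resp : ∀ {S F G} → (∀ x → F x ≈ G x [mod p ]) → CM S F → CM S G
  CountMod-resp F≈G (counting φs c b) = counting φs (λ x → ≈-trans (c x) (F≈G x)) b

  CountMod-≤ : ∀ {S S′ F} → S ≤ S′ → CM S F → CM S′ F
  CountMod-≤ S≤S′ (counting φs c b) = counting φs c (≤-trans b S≤S′)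

  CountMod-0 : ∀ {S} → CM S (λ _ → 0)
  CountMod-0 = counting [] (λ _ → ≈-refl) z≤n

  CountMod-+ : ∀ {S T F G} → CM S F → CM T G → CM (S + T) (λ x → F x + G x)
  CountMod-+ (counting φs c b) (counting ψs c′ b′) = counting (φs ++ ψs)
    (λ x → ≈-trans (≈-reflexive (count-++ φs ψs x)) (+-cong-≈ (c x) (c′ x)))
    (≤-trans (≤-reflexive (sizes-++ φs ψs)) (+-mono-≤ b b′))

  CountMod-* : ∀ {S F} c → CM S F → CM (c * S) (λ x → c * F x)
  CountMod-* zero    φ = CountMod-0
  CountMod-* (suc c) φ = CountMod-+ φ (CountMod-* c φ)

  CountMod-1 : CM 0 (λ _ → 1)
  CountMod-1 = counting (one ∷ []) (λ _ → ≈-refl) z≤n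

  CountMod-sum : ∀ {S} k {F : ℕ → Vec Bool n → ℕ} → (∀ i → i < k → CM S (F i)) →
    CM (k * S) (λ x → sumTo k (λ i → F i x))
  CountMod-sum zero    φ = CountMod-0
  CountMod-sum (suc k) φ = CountMod-+ (φ 0 z<s) (CountMod-sum k λ i i<k → φ (suc i) (s<s i<k))

module _ {m n p q d : ℕ} where

  private GS = GateSum m n p q d

  GateSum-resp : ∀ {W B F G} → (∀ x → F x ≈ G x [mod p ]) → GS W B F → GS W B G
  GateSum-resp F≈G (summing g c f s) = summing g (λ x → ≈-trans (c x) (F≈G x)) f s

  GateSum-≤ : ∀ {W W′ B B′ F} → W ≤ W′ → B ≤ B′ → GS W B F → GS W′ B′ F
  GateSum-≤ W≤W′ B≤B′ (summing g c f s) =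
    summing g c (≤-trans f W≤W′) (All.map (λ b → ≤-trans b B≤B′) s)

  GateSum-0 : ∀ {W B} → GS W B (λ _ → 0)
  GateSum-0 = summing [] (λ _ → ≈-refl) z≤n []

  GateSum-gate : ∀ {B} φs → sizes φs ≤ B → GS 1 B (λ x → χ q (count φs x))
  GateSum-gate φs b = summing (φs ∷ []) (λ x → ≈-reflexive (+-identityʳ _)) ≤-refl (b ∷ [])

  GateSum-+ : ∀ {V W B F G} → GS V B F → GS W B G → GS (V + W) B (λ x → F x + G x)
  GateSum-+ (summing g c f s) (summing g′ c′ f′ s′) = summing (g ++ g′)
    (λ x → ≈-trans (≈-reflexive (gateCount-++ q g g′ x)) (+-cong-≈ (c x) (c′ x)))
    (≤-trans (≤-reflexive (length-++ g)) (+-mono-≤ f f′))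
    (All.++⁺ s s′)

  GateSum-* : ∀ {W B F} c → GS W B F → GS (c * W) B (λ x → c * F x)
  GateSum-* zero    g = GateSum-0
  GateSum-* (suc c) g = GateSum-+ g (GateSum-* c g)

  -- A gate without inputs has the sum 0 and therefore always outputs 1; c copies of it count to c.
  GateSum-constant : ∀ {B} c → GS c B (λ _ → c)
  GateSum-constant c = GateSum-resp (λ _ → ≈-reflexive (trans (cong (c *_) (χ-∣ (q ∣0))) (*-identityʳ c)))
    (GateSum-≤ (≤-reflexive (*-identityʳ c)) ≤-refl (GateSum-* c (GateSum-gate [] z≤n)))

  GateSum-sum : ∀ {W B} k {F : ℕ → Vec Bool n → ℕ} → (∀ i → i < k → GS W B (F i)) →
    GS (k * W) B (λ x → sumTo k (λ i → F i x))
  GateSum-sum zero    g = GateSum-0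
  GateSum-sum (suc k) g = GateSum-+ (g 0 z<s) (GateSum-sum k λ i i<k → g (suc i) (s<s i<k))

  GateSum⇒CountMod : ∀ {W B F} → q ∣ m → GS W B F → CountMod m n p (suc d) (W * suc B) F
  GateSum⇒CountMod {W} {B} q∣m (summing g c f s) =
    counting (map (mod q q∣m) g) (λ x → ≈-trans (≈-reflexive (count-map g x)) (c x))
      (≤-trans (sizes-map s) (*-monoˡ-≤ (suc B) f))
    where
    count-map : ∀ g x → count (map (mod q q∣m) g) x ≡ gateCount q g x
    count-map []       x = refl
    count-map (φs ∷ g) x = cong (χ q (count φs x) +_) (count-map g x)
    sizes-map : ∀ {g} → All (λ φs → sizes φs ≤ B) g → sizes (map (mod q q∣m) g) ≤ length g * suc B
    sizes-map []      = z≤n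
    sizes-map (b ∷ s) = +-mono-≤ (s≤s b) (sizes-map s)

  -- Products of a bit with MOD_q gates

  module _ (pp : Prime p) (pq : Prime q) (p≢q : p ≢ q) where

    private

      progression : ∀ {B V} (ψs : List (Formula m n d)) → sizes ψs ≤ V → ∀ k φs → sizes φs + k * V ≤ B →
        GS k B (λ x → χ-progression q k (count φs x) (count ψs x))
      progression         ψs ψs≤V zero      φs bound = GateSum-0
      progression {V = V} ψs ψs≤V (suc k) φs bound = GateSum-+
        (GateSum-gate φs (≤-trans (m≤m+n _ _) bound))
        (GateSum-resp (λ x → ≈-reflexive (cong (λ u → χ-progression q k u (count ψs x)) (count-++ ψs φs x)))
          (progression ψs ψs≤V k (ψs ++ φs) (≤-trans step bound)))
        where
        step : sizes (ψs ++ φs) + k * V ≤ sizes φs + suc k * V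
        step = begin
          sizes (ψs ++ φs) + k * V         ≡⟨ cong (_+ k * V) (sizes-++ ψs φs) ⟩
          sizes ψs + sizes φs + k * V      ≤⟨ +-monoˡ-≤ (k * V) (+-monoˡ-≤ (sizes φs) ψs≤V) ⟩
          V + sizes φs + k * V             ≡⟨ cong (_+ k * V) (+-comm V (sizes φs)) ⟩
          sizes φs + V + k * V             ≡⟨ +-assoc (sizes φs) V (k * V) ⟩
          sizes φs + suc k * V             ∎
          where open ≤-Reasoning

    -- The negated bit is required modulo q because it becomes the step of a progression of gates.
    -- Each gate turns into q gates of that progression, one gate for the negated bit and p - 1
    -- constant ones cancelling the surplus 1, all repeated as often as the inverse of q modulo p
    -- demands, at most p times. A gate receives at most q copies of the formulas for the negated
    -- bit.
    GateSum-bit : ∀ {W B V F} (y : Vec Bool n → Bool) → CountMod m n q d V (λ x → bit (not (y x))) →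
      GS W B F → GS (W * (p * (q + p))) (B + q * V) (λ x → bit (y x) * F x)
    GateSum-bit {B = B} {V} y (counting ψs ȳ b) (summing g c f s) = GateSum-resp
      (λ x → *-congˡ-≈ (bit (y x)) (c x))
      (GateSum-≤ (*-monoˡ-≤ (p * (q + p)) f) ≤-refl (all s))
      where
      q⁻¹ : ∃ λ c → c ≤ p × c * q ≈ 1 [mod p ]
      q⁻¹ = inverse pp (prime≢⇒coprime pp pq p≢q)

      r : ℕ
      r = proj₁ q⁻¹

      product-with-gate : ∀ φs x →
        r * (χ-progression q q (count φs x) (count ψs x) + χ q (count ψs x) + (p ∸ 1))
          ≈ bit (y x) * χ q (count φs x) [mod p ]
      product-with-gate φs x = begin
        r * (χ-progression q q u (count ψs x) + χ q (count ψs x) + (p ∸ 1))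
          ≈⟨ ≈-reflexive (cong (λ z → r * (z + (p ∸ 1))) (trans
               (cong₂ _+_ (χ-progression-cong q q (≈-refl {a = u}) (ȳ x)) (χ-cong (ȳ x)))
               (χ-progression-bit (prime>1 pq) (y x) u))) ⟩
        r * (q * z + 1 + (p ∸ 1))
          ≈⟨ ≈-reflexive (cong (r *_) (trans (+-assoc (q * z) 1 (p ∸ 1)) (cong (q * z +_) (1+[p∸1]≡p pp)))) ⟩
        r * (q * z + p)
          ≈⟨ *-congˡ-≈ r (≈-trans (≈-reflexive (cong (q * z +_) (sym (*-identityˡ p)))) (+-multiple-≈ 1 (q * z))) ⟩
        r * (q * z)
          ≈⟨ ≈-reflexive (sym (*-assoc r q z)) ⟩
        r * q * z
          ≈⟨ *-congʳ-≈ z (proj₂ (proj₂ q⁻¹)) ⟩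
        1 * z
          ≈⟨ ≈-reflexive (*-identityˡ z) ⟩
        z ∎
        where
        open ≈-Reasoning p
        u = count φs x
        z = bit (y x) * χ q u

      byGate : ∀ φs → sizes φs ≤ B → GS (p * (q + p)) (B + q * V) (λ x → bit (y x) * χ q (count φs x))
      byGate φs φs≤B = GateSum-resp (product-with-gate φs)
        (GateSum-≤ (*-mono-≤ (proj₁ (proj₂ q⁻¹)) (≤-reflexive
            (trans (+-assoc q 1 (p ∸ 1)) (cong (q +_) (1+[p∸1]≡p pp))))) ≤-refl
          (GateSum-* r (GateSum-+ (GateSum-+
            (progression ψs b q φs (+-monoˡ-≤ (q * V) φs≤B))
            (GateSum-gate ψs (≤-trans b (≤-trans V≤qV (m≤n+m _ B)))))
            (GateSum-constant (p ∸ 1)))))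
        where
        V≤qV : V ≤ q * V
        V≤qV = ≤-trans (≤-reflexive (sym (*-identityˡ V))) (*-monoˡ-≤ V (<⇒≤ (prime>1 pq)))

      all : ∀ {g} → All (λ φs → sizes φs ≤ B) g →
        GS (length g * (p * (q + p))) (B + q * V) (λ x → bit (y x) * gateCount q g x)
      all {[]}     []           = GateSum-resp (λ x → ≈-reflexive (sym (*-zeroʳ (bit (y x))))) GateSum-0
      all {φs ∷ g} (φs≤B ∷ s)   = GateSum-resp
        (λ x → ≈-reflexive (sym (*-distribˡ-+ (bit (y x)) (χ q (count φs x)) (gateCount q g x))))
        (GateSum-+ (byGate φs φs≤B) (all s))

-- Symmetric functions of a list of input positions

onesAt : ∀ {n} → List (Fin n) → Vec Bool n → ℕ
onesAt []       x = 0
onesAt (i ∷ is) x = bit (lookup x i) + onesAt is x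

onesAt-++ : ∀ {n} (is js : List (Fin n)) x → onesAt (is ++ js) x ≡ onesAt is x + onesAt js x
onesAt-++ []       js x = refl
onesAt-++ (i ∷ is) js x = trans (cong (bit (lookup x i) +_) (onesAt-++ is js x))
  (sym (+-assoc (bit (lookup x i)) _ _))

bit≤1 : ∀ b → bit b ≤ 1
bit≤1 true  = ≤-refl
bit≤1 false = z≤n

onesAt≤length : ∀ {n} (is : List (Fin n)) x → onesAt is x ≤ length is
onesAt≤length []       x = z≤n
onesAt≤length (i ∷ is) x = +-mono-≤ (bit≤1 (lookup x i)) (onesAt≤length is x)

onesAt-tabulate : ∀ {k n} (x : Vec Bool k) (y : Vec Bool n) (ι : Fin k → Fin n) →
  (∀ i → lookup y (ι i) ≡ lookup x i) → onesAt (tabulate ι) y ≡ ones x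
onesAt-tabulate []          y ι eq = refl
onesAt-tabulate (true  ∷ x) y ι eq = cong₂ _+_ (cong bit (eq zero)) (onesAt-tabulate x y (ι ∘ suc) (eq ∘ suc))
onesAt-tabulate (false ∷ x) y ι eq = cong₂ _+_ (cong bit (eq zero)) (onesAt-tabulate x y (ι ∘ suc) (eq ∘ suc))

onesAt-allFin : ∀ {n} (x : Vec Bool n) → onesAt (allFin n) x ≡ ones x
onesAt-allFin x = onesAt-tabulate x x (λ i → i) (λ _ → refl)

-- Pairwise coprime moduli

coprime-product : ∀ {c as} → All (Coprime c) as → Coprime c (product as)
coprime-product             []           = Coprimality.sym (Coprimality.1-coprimeTo _)
coprime-product {c} {a ∷ as} (c⊥a ∷ c⊥as) = Coprimality.sym
  (coprime-* {a} {product as} (Coprimality.sym c⊥a) (Coprimality.sym (coprime-product c⊥as)))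

*-∣ : ∀ {a b w} → Coprime a b → a ∣ w → b ∣ w → a * b ∣ w
*-∣ {a} {b} a⊥b (divides k refl) b∣w = subst (a * b ∣_) (*-comm a k)
  (*-monoʳ-∣ a (coprime-divisor (Coprimality.sym a⊥b) (subst (b ∣_) (*-comm k a) b∣w)))

product-∣ : ∀ {as w} → AllPairs Coprime as → All (_∣ w) as → product as ∣ w
product-∣ []           []           = 1∣ _
product-∣ {a ∷ as} (a⊥as ∷ as⊥) (a∣w ∷ as∣w) = *-∣ (coprime-product a⊥as) a∣w (product-∣ as⊥ as∣w)

distinctPrimes-coprime : ∀ {ps} → All Prime ps → Unique ps → AllPairs Coprime ps
distinctPrimes-coprime []         []           = []
distinctPrimes-coprime (pp ∷ pps) (p≢ps ∷ ps!) =
  coprime-to pps p≢ps ∷ distinctPrimes-coprime pps ps!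
  where
  coprime-to : ∀ {qs} → All Prime qs → All (_ ≢_) qs → All (Coprime _) qs
  coprime-to []         []           = []
  coprime-to (pq ∷ pqs) (p≢q ∷ p≢qs) = prime≢⇒coprime pp pq p≢q ∷ coprime-to pqs p≢qs

powers-coprime : ∀ (e : ℕ → ℕ) {ps} → AllPairs Coprime ps → AllPairs Coprime (map (λ p → p ^ e p) ps)
powers-coprime e []           = []
powers-coprime e {p ∷ _} (p⊥ps ∷ ps⊥) = All.map⁺ (All.map power p⊥ps) ∷ powers-coprime e ps⊥
  where
  power : ∀ {q} → Coprime p q → Coprime (p ^ e p) (q ^ e q)
  power {q} p⊥q = coprime-^ (e p) (Coprimality.sym (coprime-^ (e q) (Coprimality.sym p⊥q)))

factors-∣ : ∀ as → All (_∣ product as) as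
factors-∣ []       = []
factors-∣ (a ∷ as) = m∣m*n (product as) ∷ All.map (∣n⇒∣m*n a) (factors-∣ as)

^-length≤product : ∀ {b as} → All (b ≤_) as → b ^ length as ≤ product as
^-length≤product []             = ≤-refl
^-length≤product (b≤a ∷ b≤as) = *-mono-≤ b≤a (^-length≤product b≤as)

-- Prime powers just above s

exponent : ℕ → ℕ → ℕ
exponent p zero = 0
exponent p (suc s) with suc s <? p ^ exponent p s
... | yes _ = exponent p s
... | no  _ = suc (exponent p s)

exponent-lower : ∀ {p} → 1 < p → ∀ s → s < p ^ exponent p s
exponent-lower     1<p zero    = z<s
exponent-lower {p} 1<p (suc s) with suc s <? p ^ exponent p s
... | yes s<p^e = s<p^e
... | no  _     = ≤-<-trans (exponent-lower 1<p s)
  (^-monoʳ-< p 1<p (n<1+n (exponent p s)))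

-- The exponent increases only when the old power is at most the new s, so the new power is at most
-- p times that s. The extra 1 covers s = 0.
exponent-upper : ∀ p s → p ^ exponent p s ≤ suc (p * s)
exponent-upper p zero    = s≤s z≤n
exponent-upper p (suc s) with suc s <? p ^ exponent p s
... | yes _     = ≤-trans (exponent-upper p s) (s≤s (*-monoʳ-≤ p (n≤1+n s)))
... | no  s≮p^e = ≤-trans (*-monoʳ-≤ p (≮⇒≥ s≮p^e)) (n≤1+n _)

-- Modulus 0 makes the congruence an equality.
exact : ∀ {m n p d S F} → CountMod m n p d S F →
  ∃ λ G → CountMod m n 0 d S G × (∀ x → G x ≈ F x [mod p ])
exact (counting φs c b) = count φs , counting φs (λ _ → ≈-refl) b , c

≈-mod-0 : ∀ {a b} → a ≈ b [mod 0 ] → a ≡ b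
≈-mod-0 {a} {b} (shift u v eq) = begin
  a         ≡⟨ +-identityʳ a ⟨
  a + 0     ≡⟨ cong (a +_) (*-zeroʳ u) ⟨
  a + u * 0 ≡⟨ eq ⟩
  b + v * 0 ≡⟨ cong (b +_) (*-zeroʳ v) ⟩
  b + 0     ≡⟨ +-identityʳ b ⟩
  b         ∎
  where open ≡-Reasoning

-- Let P be the product of the remaining moduli. As a and P are coprime, a * P divides P * G₁ + a *
-- G₂ exactly when a divides G₁ and P divides G₂. The counts are taken exactly, since they must make
-- sense modulo the whole product although each is prescribed only modulo its own factor.
CountMod-conjunction : ∀ {m n d S} {F : ℕ → Vec Bool n → ℕ} {as} → AllPairs Coprime as →
  All (λ a → 1 ≤ a × CountMod m n a d S (F a)) as →
  ∃ λ G → CountMod m n 0 d (length as * (product as * S)) G ×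
    (∀ x → product as ∣ G x → All (λ a → a ∣ F a x) as) ×
    (∀ x → All (λ a → a ∣ F a x) as → product as ∣ G x)
CountMod-conjunction [] [] = (λ _ → 0) , CountMod-0 , (λ _ _ → []) , (λ _ _ → 1 ∣0)
CountMod-conjunction {S = S} {F = F} {as = a ∷ as} (a⊥as ∷ as⊥) ((1≤a , φ) ∷ φs)
  with exact φ | CountMod-conjunction {F = F} as⊥ φs
... | G₁ , φ₁ , G₁≈F | G₂ , φ₂ , split , join =
  (λ x → P * G₁ x + a * G₂ x) , CountMod-≤ bound (CountMod-+ (CountMod-* P φ₁) (CountMod-* a φ₂)) ,
  split′ , join′
  where
  P = product as
  a⊥P : Coprime a P
  a⊥P = coprime-product a⊥as
  split′ : ∀ x → a * P ∣ P * G₁ x + a * G₂ x → All (λ a → a ∣ F a x) (a ∷ as)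
  split′ x aP∣ =
    ∣-resp-≈ (G₁≈F x) (coprime-divisor a⊥P
      (∣m+n∣m⇒∣n (subst (a ∣_) (+-comm (P * G₁ x) _) (m*n∣⇒m∣ a P aP∣)) (m∣m*n (G₂ x)))) ∷
    split x (coprime-divisor (Coprimality.sym a⊥P) (∣m+n∣m⇒∣n (m*n∣⇒n∣ a P aP∣) (m∣m*n (G₁ x))))
  join′ : ∀ x → All (λ a → a ∣ F a x) (a ∷ as) → a * P ∣ P * G₁ x + a * G₂ x
  join′ x (a∣ ∷ as∣) = ∣m∣n⇒∣m+n
    (subst (_∣ P * G₁ x) (*-comm P a) (*-monoʳ-∣ P (∣-resp-≈ (≈-sym (G₁≈F x)) a∣)))
    (*-monoʳ-∣ a (join x as∣))
  lemma : ∀ a P S l → a * (P * S) + a * (l * (P * S)) ≡ suc l * (a * P * S)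
  lemma = solve-∀
  bound : P * S + a * (length as * (P * S)) ≤ suc (length as) * (a * P * S)
  bound = ≤-trans
    (+-monoˡ-≤ _ (≤-trans (≤-reflexive (sym (*-identityˡ (P * S)))) (*-monoˡ-≤ (P * S) 1≤a)))
    (≤-reflexive (lemma a P S (length as)))

-- The negation 1 - b is written as 1 + (q - 1) b; constants and variables have size 0, so this
-- takes no gate.
CountMod-negated-var : ∀ {m n q} → 1 < q → ∀ i → CountMod m n q 0 0 (λ x → bit (not (lookup x i)))
CountMod-negated-var {q = q} 1<q i = CountMod-≤ (≤-reflexive (*-zeroʳ (q ∸ 1)))
  (CountMod-resp (λ x → negate (lookup x i))
    (CountMod-+ CountMod-1 (CountMod-* (q ∸ 1) (counting (var i ∷ []) (λ _ → ≈-refl) z≤n))))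
  where
  negate : ∀ b → 1 + (q ∸ 1) * (bit b + 0) ≈ bit (not b) [mod q ]
  negate false = ≈-reflexive (cong suc (*-zeroʳ (q ∸ 1)))
  negate true  = ∣⇒≈0 (∣-reflexive (sym (trans (cong suc (*-identityʳ (q ∸ 1))) (m+[n∸m]≡n (<⇒≤ 1<q)))))

-- Polynomials in the inputs as sums of MOD_q gates

module _ {m n p q : ℕ} (pp : Prime p) (pq : Prime q) (p≢q : p ≢ q) where

  private
    a K : ℕ
    a = p ∸ 1
    -- A product with a bit multiplies the number of gates by p * (q + p), and the scalar a by less
    -- than another p.
    K = p * (p * (q + p))

    instance
      _ = prime⇒nonZero pp
      _ = prime⇒nonZero pq
      q+p≢0 : NonZero (q + p)
      q+p≢0 = >-nonZero (≤-trans (>-nonZero⁻¹ q) (m≤m+n q p))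
      K′≢0 : NonZero (p * (q + p))
      K′≢0 = m*n≢0 p (q + p)
      K≢0 : NonZero K
      K≢0 = m*n≢0 p (p * (q + p))

  GateSum-constant-≤ : ∀ {d B} c X → 1 ≤ X → GateSum m n p q d (p * X) B (λ _ → c)
  GateSum-constant-≤ c X 1≤X with residue pp c
  ... | c′ , c′≤p , c′≈c = GateSum-resp (λ _ → c′≈c) (GateSum-≤
    (≤-trans c′≤p (≤-trans (≤-reflexive (sym (*-identityʳ p))) (*-monoʳ-≤ p 1≤X))) ≤-refl
    (GateSum-constant c′))

  -- g (b + N) = g N - b Δg N for a bit b, and a = p - 1 stands for -1.
  Δ-step : ∀ g b N → g N + a * (bit b * Δ a g N) ≈ g (bit b + N) [mod p ]
  Δ-step g false N = ≈-reflexive (trans (cong (g N +_) (*-zeroʳ a)) (+-identityʳ (g N)))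
  Δ-step g true  N = shift (g (suc N)) (g N + a * g (suc N))
    (subst (λ p → g N + a * (1 * Δ a g N) + g (suc N) * p ≡ g (suc N) + (g N + a * g (suc N)) * p)
      (1+[p∸1]≡p pp) (lemma a (g N) (g (suc N))))
    where
    lemma : ∀ a x y → x + a * (1 * (x + a * y)) + y * (1 + a) ≡ y + (x + a * y) * (1 + a)
    lemma = solve-∀

  -- `Δ-step` splits off one input: one summand keeps the order k with an input fewer, the other has
  -- order k - 1 and is multiplied by a bit. At order 0 the function itself vanishes modulo p. The
  -- bits need no gates, so the inputs of the gates stay of size 0.
  GateSum-polynomial : ∀ k g (is : List (Fin n)) → (∀ N → Δ^ a k g N ≈ 0 [mod p ]) →
    GateSum m n p q 0 (p * (suc (length is) * K) ^ k) 0 (g ∘ onesAt is)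
  GateSum-polynomial zero    g is       Δ≈0 = GateSum-resp (λ x → ≈-sym (Δ≈0 (onesAt is x))) GateSum-0
  GateSum-polynomial (suc k) g []       Δ≈0 = GateSum-constant-≤ (g 0) _ (m^n>0 (1 * K) (suc k))
    where instance _ = m*n≢0 1 K
  GateSum-polynomial (suc k) g (i ∷ is) Δ≈0 = GateSum-resp (λ x → Δ-step g (lookup x i) (onesAt is x))
    (GateSum-≤ bound (≤-reflexive (*-zeroʳ q))
      (GateSum-+ (GateSum-≤ ≤-refl z≤n (GateSum-polynomial (suc k) g is Δ≈0))
        (GateSum-* a (GateSum-bit pp pq p≢q (λ x → lookup x i)
          (CountMod-negated-var (prime>1 pq) i) (GateSum-polynomial k (Δ a g) is Δ≈0)))))
    where
    X = suc (length is) * K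
    lemma : ∀ p X Y K′ → p * (X * Y) + p * (p * Y * K′) ≡ p * ((p * K′ + X) * Y)
    lemma = solve-∀
    bound : p * X ^ suc k + a * (p * X ^ k * (p * (q + p))) ≤ p * (K + X) ^ suc k
    bound = begin
      p * X ^ suc k + a * (p * X ^ k * (p * (q + p)))
        ≤⟨ +-monoʳ-≤ (p * X ^ suc k) (*-monoˡ-≤ (p * X ^ k * (p * (q + p))) (m∸n≤m p 1)) ⟩
      p * X ^ suc k + p * (p * X ^ k * (p * (q + p)))
        ≡⟨ lemma p X (X ^ k) (p * (q + p)) ⟩
      p * ((K + X) * X ^ k)
        ≤⟨ *-monoʳ-≤ p (*-monoʳ-≤ (K + X) (^-monoˡ-≤ k (m≤n+m X K))) ⟩
      p * (K + X) ^ suc k ∎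
      where open ≤-Reasoning

  -- The indicator is negated so that p divides it exactly when the congruence holds; w selects the
  -- residue class. Its period p ^ e bounds its degree by `Δ^-periodic`.
  GateSum-residue : ∀ e → 1 < p ^ e → ∀ w (is : List (Fin n)) →
    GateSum m n p q 0 (p * (suc (length is) * K) ^ (p ^ e)) 0
      (λ x → bit (not (does (p ^ e ∣? (onesAt is x + w)))))
  GateSum-residue e 1<p^e w is = GateSum-polynomial (p ^ e) _ is
    (Δ^-periodic (1+[p∸1]≡p pp) pp e 1<p^e (λ N → bit (not (does (p ^ e ∣? (N + w))))) periodic)
    where
    rotate : ∀ N Q w → Q + (N + w) ≡ N + Q + w
    rotate = solve-∀
    periodic : ∀ N → bit (not (does (p ^ e ∣? (N + p ^ e + w)))) ≡ bit (not (does (p ^ e ∣? (N + w))))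
    periodic N with p ^ e ∣? (N + w)
    ... | yes q∣ = cong (bit ∘ not) (dec-true (p ^ e ∣? (N + p ^ e + w))
      (subst (p ^ e ∣_) (rotate N (p ^ e) w) (∣m∣n⇒∣m+n ∣-refl q∣)))
    ... | no q∤ = cong (bit ∘ not) (dec-false (p ^ e ∣? (N + p ^ e + w))
      (λ q∣ → q∤ (∣m+n∣m⇒∣n (subst (p ^ e ∣_) (sym (rotate N (p ^ e) w)) q∣) ∣-refl)))

-- Splitting the inputs into blocks

module _ {m n p q d : ℕ} (pp : Prime p) (pq : Prime q) (p≢q : p ≢ q) where

  private instance
    _ = prime⇒nonZero pp
    _ = prime⇒nonZero pq

  -- A case distinction on the number c of ones in the first block writes the function as a sum over
  -- c of the indicator of c times a function of the other blocks. `GateSum-bit` forms these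
  -- products, and the hypothesis supplies the negated indicators modulo q. A block thus adds q * V
  -- to the inputs of a gate.
  GateSum-blocks : ∀ {ℓ V} →
    (∀ (b : List (Fin n)) → length b ≤ ℓ → ∀ h → CountMod m n q d V (h ∘ onesAt b)) →
    ∀ i (is : List (Fin n)) → length is ≤ i * ℓ → ∀ h →
    GateSum m n p q d (p * (suc ℓ * (p * (q + p))) ^ i) (i * (q * V)) (h ∘ onesAt is)
  GateSum-blocks         block zero    []       _    h = GateSum-constant-≤ pp pq p≢q (h 0) 1 ≤-refl
  GateSum-blocks {ℓ = ℓ} {V} block (suc i) is len h = GateSum-resp (λ x → ≈-reflexive (select x))
    (GateSum-≤ (≤-reflexive (lemma p ℓ (p * (q + p)) _)) (≤-reflexive (+-comm (i * (q * V)) (q * V)))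
      (GateSum-sum (suc ℓ) λ c _ → GateSum-bit pp pq p≢q (λ x → onesAt b x ≡ᵇ c)
        (block b b≤ℓ λ N → bit (not (N ≡ᵇ c)))
        (GateSum-blocks block i rest rest≤ (λ N → h (c + N)))))
    where
    b    = take ℓ is
    rest = drop ℓ is
    b≤ℓ : length b ≤ ℓ
    b≤ℓ = ≤-trans (≤-reflexive (length-take ℓ is)) (m⊓n≤m ℓ _)
    rest≤ : length rest ≤ i * ℓ
    rest≤ = ≤-trans (≤-reflexive (length-drop ℓ is)) (m≤n+o⇒m∸n≤o (length is) ℓ len)
    select : ∀ x → sumTo (suc ℓ) (λ c → bit (onesAt b x ≡ᵇ c) * h (c + onesAt rest x)) ≡ h (onesAt is x)
    select x = trans
      (sumTo-select (s≤s (≤-trans (onesAt≤length b x) b≤ℓ)) (λ c → h (c + onesAt rest x)))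
      (cong h (trans (sym (onesAt-++ b rest x)) (cong (λ js → onesAt js x) (take++drop≡id ℓ is))))
    lemma : ∀ p ℓ κ Y → suc ℓ * (p * Y * κ) ≡ p * (suc ℓ * κ * Y)
    lemma = solve-∀

∣bit-not : ∀ {p Q w} → 1 < p → p ∣ bit (not (does (Q ∣? w))) → Q ∣ w
∣bit-not {p} {Q} {w} 1<p p∣ with Q ∣? w
... | yes Q∣w = Q∣w
... | no  _   = contradiction (∣⇒≤ p∣) (<⇒≱ 1<p)

∣-bit-not : ∀ {p Q w} → Q ∣ w → p ∣ bit (not (does (Q ∣? w)))
∣-bit-not {p} {Q} {w} Q∣w = subst (p ∣_) (sym (cong (bit ∘ not) (dec-true (Q ∣? w) Q∣w))) (p ∣0)

∣-+-complement : ∀ {Q N c} → 1 ≤ Q → Q ∣ N + (Q ∸ 1) * c → Q ∣ ∣ N - c ∣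
∣-+-complement {suc Q} {N} {c} _ Q∣ = ≈⇒∣distance (+-cancelʳ-≈ (Q * c) (≈-trans (∣⇒≈0 Q∣)
  (≈-sym (∣⇒≈0 (m∣m*n c)))))

∣-complement-+ : ∀ {Q c} → 1 ≤ Q → Q ∣ c + (Q ∸ 1) * c
∣-complement-+ {suc Q} {c} _ = m∣m*n c

-- Size bounds as powers of a common base

module PowerBounds {X : ℕ} (2≤X : 2 ≤ X) where

  instance
    X≢0 : NonZero X
    X≢0 = >-nonZero (≤-trans z<s 2≤X)

  infixl 7 _⊗_
  _⊗_ : ∀ {a b i j} → a ≤ X ^ i → b ≤ X ^ j → a * b ≤ X ^ (i + j)
  _⊗_ {i = i} {j} a≤ b≤ = ≤-trans (*-mono-≤ a≤ b≤) (≤-reflexive (sym (^-distribˡ-+-* X i j)))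

  base : ∀ {a} → a ≤ X → a ≤ X ^ 1
  base a≤X = ≤-trans a≤X (≤-reflexive (sym (*-identityʳ X)))

  power : ∀ {a i} → a ≤ X ^ i → ∀ k → a ^ k ≤ X ^ (i * k)
  power {i = i} a≤ k = ≤-trans (^-monoˡ-≤ k a≤) (≤-reflexive (^-*-assoc X i k))

  add : ∀ {a b i} → a ≤ X ^ i → b ≤ X ^ i → a + b ≤ X ^ suc i
  add {a} {b} {i} a≤ b≤ = ≤-trans (+-mono-≤ a≤ b≤) (≤-trans
    (≤-reflexive (cong (X ^ i +_) (sym (+-identityʳ (X ^ i))))) (*-monoˡ-≤ (X ^ i) 2≤X))

  successor : ∀ {a i} → a ≤ X ^ i → suc a ≤ X ^ suc i
  successor {i = i} a≤ = add {i = i} (m^n>0 X i) a≤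

  raise : ∀ {a i j} → i ≤ j → a ≤ X ^ i → a ≤ X ^ j
  raise i≤j a≤ = ≤-trans a≤ (^-monoʳ-≤ X i≤j)

-- The coefficient of s in the exponent of the size bound: a base value depending on m, and 8 for
-- each further level.
rate : ℕ → ℕ → ℕ
rate m zero    = 11 + 5 * m
rate m (suc j) = 8 + rate m j

-- The construction by induction on the depth

module Construction
  (ps : List ℕ) (primes : All Prime ps) (distinct : Unique ps) (nonempty : 0 < length ps)
  (partner : ∀ p → ∃ λ q → Prime q × q ∣ product ps × p ≢ q)
  (n s X : ℕ) (1≤s : 1 ≤ s) (2≤X : 2 ≤ X) (m≤X : product ps ≤ X) (r≤X : length ps ≤ X)
  where

  open PowerBounds 2≤X

  private
    m = product ps
    r = length ps

    instance
      m≢0 : NonZero m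
      m≢0 = productOfPrimes≢0 primes

  factor≤X : ∀ {p} → p ∣ m → p ≤ X
  factor≤X p∣m = ≤-trans (∣⇒≤ p∣m) m≤X

  module Counting (is : List (Fin n)) (length≤ : length is ≤ s ^ r) (length<X : length is < X) where

    Q : ℕ → ℕ
    Q p = p ^ exponent p s

    -- (Q p ∸ 1) * c stands for -c modulo Q p.
    test : ℕ → ℕ → Vec Bool n → ℕ
    test c p x = bit (not (does (Q p ∣? (onesAt is x + (Q p ∸ 1) * c))))

    CountMod-test : ∀ c {p} → Prime p → p ∣ m → CountMod m n p 1 (X ^ (6 + 5 * (m * s))) (test c p)
    CountMod-test c {p} pp p∣m with partner p
    ... | q , pq , q∣m , p≢q = CountMod-≤ bound (GateSum⇒CountMod q∣m
          (GateSum-residue pp pq p≢q (exponent p s) (≤-<-trans 1≤s (exponent-lower (prime>1 pp) s))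
            ((Q p ∸ 1) * c) is))
      where
      Q≤ : Q p ≤ 1 + m * s
      Q≤ = ≤-trans (exponent-upper p s) (s≤s (*-monoˡ-≤ s (∣⇒≤ p∣m)))
      p≤X = base (factor≤X p∣m)
      q≤X = base (factor≤X q∣m)
      exponents : 1 + 5 * Q p + 0 ≤ 6 + 5 * (m * s)
      exponents = begin
        1 + 5 * Q p + 0       ≡⟨ +-identityʳ _ ⟩
        1 + 5 * Q p           ≤⟨ s≤s (*-monoʳ-≤ 5 Q≤) ⟩
        1 + 5 * (1 + m * s)   ≡⟨ cong suc (*-distribˡ-+ 5 1 (m * s)) ⟩
        6 + 5 * (m * s)       ∎
        where open ≤-Reasoning
      -- The length and each of the two factors p cost one power of X, and q + p costs two: five in
      -- all, raised to `Q p`.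
      bound : p * (suc (length is) * (p * (p * (q + p)))) ^ Q p * 1 ≤ X ^ (6 + 5 * (m * s))
      bound = raise exponents (_⊗_ {i = 1 + 5 * Q p} {0}
        (_⊗_ {i = 1} {5 * Q p} p≤X (power {i = 5} (_⊗_ {i = 1} {4} (base length<X)
          (_⊗_ {i = 1} {3} p≤X (_⊗_ {i = 1} {2} p≤X (add {i = 1} q≤X p≤X)))) (Q p)))
        ≤-refl)

    tests : ∀ c → All (λ p → 1 ≤ p × CountMod m n p 1 (X ^ (6 + 5 * (m * s))) (test c p)) ps
    tests c = All.zipWith (λ (pp , p∣m) → <⇒≤ (prime>1 pp) , CountMod-test c pp p∣m) (primes , factors-∣ ps)

    -- Each of the r prime powers exceeds s, so their product exceeds s ^ r. Hence the residues
    -- modulo all of them determine the number of ones.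
    length<product : length is < product (map Q ps)
    length<product = begin-strict
      length is                  ≤⟨ length≤ ⟩
      s ^ r                      <⟨ ^-monoˡ-< r (n<1+n s) ⟩
      suc s ^ r                  ≡⟨ cong (suc s ^_) (length-map Q ps) ⟨
      suc s ^ length (map Q ps)  ≤⟨ ^-length≤product (All.map⁺ (All.map (λ pp → exponent-lower (prime>1 pp) s) primes)) ⟩
      product (map Q ps)         ∎
      where
      open ≤-Reasoning
      instance _ = >-nonZero nonempty

    coprime : AllPairs Coprime ps
    coprime = distinctPrimes-coprime primes distinct

    -- The product of the prime powers divides the distance of `onesAt is x` and c, which is at most
    -- the length and so below that product; the distance is therefore 0.
    tests-sound : ∀ {c} → c ≤ length is → ∀ x → All (λ p → p ∣ test c p x) ps → onesAt is x ≡ c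
    tests-sound {c} c≤ x ∣tests = ∣m-n∣≡0⇒m≡n (∣⇒≡0 (product-∣ (powers-coprime (λ p → exponent p s) coprime)
      (All.map⁺ (All.zipWith (λ {p} (pp , p∣) → ∣-+-complement (≤-trans z<s (exponent-lower (prime>1 pp) s))
        (∣bit-not (prime>1 pp) p∣)) (primes , ∣tests)))))
      where
      ∣⇒≡0 : product (map Q ps) ∣ ∣ onesAt is x - c ∣ → ∣ onesAt is x - c ∣ ≡ 0
      ∣⇒≡0 P∣ with ∣ onesAt is x - c ∣ | ≤-trans (∣m-n∣≤m⊔n (onesAt is x) c) (⊔-lub (onesAt≤length is x) c≤)
      ... | zero  | _  = refl
      ... | suc w | w≤ = contradiction (∣⇒≤ P∣) (<⇒≱ (≤-<-trans w≤ length<product))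

    tests-complete : ∀ x → All (λ p → p ∣ test (onesAt is x) p x) ps
    tests-complete x = All.map (λ pp → ∣-bit-not (∣-complement-+ (≤-trans z<s (exponent-lower (prime>1 pp) s)))) primes

    -- One MOD_m gate joins the tests, using that the primes themselves are coprime. It outputs the
    -- bit exactly, so the count is right modulo any p.
    CountMod-exactly : ∀ {p c} → c ≤ length is →
      CountMod m n p 2 (X ^ (9 + 5 * (m * s))) (λ x → bit (onesAt is x ≡ᵇ c))
    CountMod-exactly {p} {c} c≤ = conjunction-gate (CountMod-conjunction {F = test c} coprime (tests c))
      where
      conjunction-gate : (∃ λ G → CountMod m n 0 1 (r * (m * X ^ (6 + 5 * (m * s)))) G ×
          (∀ x → m ∣ G x → All (λ p → p ∣ test c p x) ps) ×
          (∀ x → All (λ p → p ∣ test c p x) ps → m ∣ G x)) →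
        CountMod m n p 2 (X ^ (9 + 5 * (m * s))) (λ x → bit (onesAt is x ≡ᵇ c))
      conjunction-gate (G , counting φs φs≈G small , split , join) = counting (mod m ∣-refl φs ∷ [])
        (λ x → ≈-reflexive (trans (+-identityʳ _) (cong bit (agree x))))
        (≤-trans (≤-reflexive (+-identityʳ _)) (successor {i = 8 + 5 * (m * s)} (≤-trans small
          (_⊗_ {i = 1} {7 + 5 * (m * s)} (base r≤X) (_⊗_ {i = 1} {6 + 5 * (m * s)} (base m≤X) ≤-refl)))))
        where
        φs≡G : ∀ x → count φs x ≡ G x
        φs≡G x = ≈-mod-0 (φs≈G x)
        agree : ∀ x → does (m ∣? count φs x) ≡ (onesAt is x ≡ᵇ c)
        agree x = decide (onesAt is x ≟ c)
          where
          decide : Dec (onesAt is x ≡ c) → does (m ∣? count φs x) ≡ (onesAt is x ≡ᵇ c)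
          decide (yes N≡c) = trans
            (dec-true (m ∣? count φs x) (subst (m ∣_) (sym (φs≡G x))
              (join x (subst (λ c → All (λ p → p ∣ test c p x) ps) N≡c (tests-complete x)))))
            (sym (dec-true (onesAt is x ≟ c) N≡c))
          decide (no N≢c)  = trans
            (dec-false (m ∣? count φs x)
              (λ m∣ → N≢c (tests-sound c≤ x (split x (subst (m ∣_) (φs≡G x) m∣)))))
            (sym (dec-false (onesAt is x ≟ c) N≢c))

    CountMod-function : ∀ {p} → Prime p → p ∣ m → (h : ℕ → ℕ) →
      CountMod m n p 2 (X ^ (11 + 5 * (m * s))) (h ∘ onesAt is)
    CountMod-function {p} pp p∣m h = CountMod-≤
      (_⊗_ {i = 1} {10 + 5 * (m * s)} (base length<X) ≤-refl)
      (CountMod-resp (λ x → ≈-reflexive (trans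
          (sumTo-cong (suc (length is)) (λ c → *-comm (h c) (bit (onesAt is x ≡ᵇ c))))
          (sumTo-select (s≤s (onesAt≤length is x)) h)))
        (CountMod-sum (suc (length is)) λ c c≤ → term c (≤-pred c≤)))
      where
      term : ∀ c → c ≤ length is →
        CountMod m n p 2 (X ^ (10 + 5 * (m * s))) (λ x → h c * bit (onesAt is x ≡ᵇ c))
      term c c≤ with residue pp (h c)
      ... | c′ , c′≤p , c′≈hc = CountMod-resp (λ x → *-congʳ-≈ (bit (onesAt is x ≡ᵇ c)) c′≈hc) (CountMod-≤
        (_⊗_ {i = 1} {9 + 5 * (m * s)} (base (≤-trans c′≤p (factor≤X p∣m))) ≤-refl)
        (CountMod-* c′ (CountMod-exactly c≤)))

  -- The primes change from level to level: a count modulo p is made of MOD_q gates for the partner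
  -- q, whose inputs are functions of the blocks counted modulo q by the induction hypothesis.
  CountMod-onesAt : ∀ j (is : List (Fin n)) → length is ≤ s ^ (j + r) → s ^ (j + r) < X →
    ∀ {p} → Prime p → p ∣ m → (h : ℕ → ℕ) →
    CountMod m n p (2 + j) (X ^ (rate m j * s)) (h ∘ onesAt is)
  CountMod-onesAt zero    is length≤ <X pp p∣m h =
    CountMod-≤ (^-monoʳ-≤ X exponents) (Counting.CountMod-function is length≤ (≤-<-trans length≤ <X) pp p∣m h)
    where
    instance _ = >-nonZero 1≤s
    exponents : 11 + 5 * (m * s) ≤ (11 + 5 * m) * s
    exponents = begin
      11 + 5 * (m * s)      ≤⟨ +-monoˡ-≤ _ (m≤m*n 11 s) ⟩
      11 * s + 5 * (m * s)  ≡⟨ cong (11 * s +_) (*-assoc 5 m s) ⟨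
      11 * s + 5 * m * s    ≡⟨ *-distribʳ-+ s 11 (5 * m) ⟨
      (11 + 5 * m) * s      ∎
      where open ≤-Reasoning
  CountMod-onesAt (suc j) is length≤ <X {p} pp p∣m h with partner p
  ... | q , pq , q∣m , p≢q = CountMod-≤ bound (GateSum⇒CountMod q∣m
        (GateSum-blocks pp pq p≢q (λ b b≤ h → CountMod-onesAt j b b≤ (≤-<-trans ℓ≤sℓ <X) pq q∣m h)
          s is length≤ h))
    where
    ℓ = s ^ (j + r)
    e = rate m j * s
    instance
      _ = >-nonZero 1≤s
      ℓ≢0 : NonZero ℓ
      ℓ≢0 = m^n≢0 s (j + r)
    ℓ≤sℓ : ℓ ≤ s * ℓ
    ℓ≤sℓ = m≤n*m ℓ s
    s≤X : s ≤ X ^ 1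
    s≤X = base (≤-trans (m≤m*n s ℓ) (<⇒≤ <X))
    p≤X = base (factor≤X p∣m)
    q≤X = base (factor≤X q∣m)
    lemma : ∀ s c → s * 4 + 4 * s + c * s ≡ (8 + c) * s
    lemma = solve-∀
    -- Each of the s blocks costs four powers of X. The four single powers are absorbed into another
    -- 4 * s because 1 ≤ s, which makes 8 per level.
    exponents : 1 + 4 * s + (3 + e) ≤ (8 + rate m j) * s
    exponents = begin
      1 + 4 * s + (3 + e)     ≡⟨ shuffle (4 * s) e ⟩
      4 + 4 * s + e           ≤⟨ +-monoˡ-≤ e (+-monoˡ-≤ (4 * s) (m≤n*m 4 s)) ⟩
      s * 4 + 4 * s + e       ≡⟨ lemma s (rate m j) ⟩
      (8 + rate m j) * s        ∎
      where
      open ≤-Reasoning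
      shuffle : ∀ a e → 1 + a + (3 + e) ≡ 4 + a + e
      shuffle = solve-∀
    bound : p * (suc ℓ * (p * (q + p))) ^ s * suc (s * (q * X ^ e)) ≤ X ^ ((8 + rate m j) * s)
    bound = raise exponents (_⊗_ {i = 1 + 4 * s} {3 + e}
      (_⊗_ {i = 1} {4 * s} p≤X (power {i = 4} (_⊗_ {i = 1} {3} (base (≤-<-trans ℓ≤sℓ <X))
        (_⊗_ {i = 1} {2} p≤X (add {i = 1} q≤X p≤X))) s))
      (successor {i = 2 + e} (_⊗_ {i = 1} {1 + e} s≤X (_⊗_ {i = 1} {e} q≤X ≤-refl))))

-- Compilation of formulas to circuits

lookup-∷ʳ-inject₁ : ∀ {A : Set} {k} (v : Vec A k) a i → lookup (v ∷ʳ a) (inject₁ i) ≡ lookup v i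
lookup-∷ʳ-inject₁ (b ∷ v) a zero    = refl
lookup-∷ʳ-inject₁ (b ∷ v) a (suc i) = lookup-∷ʳ-inject₁ v a i

lookup-∷ʳ-fromℕ : ∀ {A : Set} {k} (v : Vec A k) a → lookup (v ∷ʳ a) (fromℕ k) ≡ a
lookup-∷ʳ-fromℕ []      a = refl
lookup-∷ʳ-fromℕ (b ∷ v) a = lookup-∷ʳ-fromℕ v a

last-∷ʳ : ∀ {A : Set} {k} (v : Vec A k) a → last (v ∷ʳ a) ≡ a
last-∷ʳ []      a = refl
last-∷ʳ (b ∷ v) a = last-∷ʳ v a

module _ {m n : ℕ} where

  wireSum-++ : ∀ {k} (x : Vec Bool n) (g : Vec Bool k) ws vs →
    wireSum x g (ws ++ vs) ≡ wireSum x g ws + wireSum x g vs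
  wireSum-++ x g []              vs = refl
  wireSum-++ x g (input i ∷ ws)  vs =
    trans (cong (bit (lookup x i) +_) (wireSum-++ x g ws vs)) (sym (+-assoc (bit (lookup x i)) _ _))
  wireSum-++ x g (Source.one ∷ ws) vs = cong suc (wireSum-++ x g ws vs)
  wireSum-++ x g (gate j ∷ ws)   vs =
    trans (cong (bit (lookup g j) +_) (wireSum-++ x g ws vs)) (sym (+-assoc (bit (lookup g j)) _ _))

  maxDepth-++ : ∀ {k} (ds : Vec ℕ k) (ws vs : List (Source n k)) →
    maxDepth ds (ws ++ vs) ≡ maxDepth ds ws ⊔ maxDepth ds vs
  maxDepth-++ ds []       vs = refl
  maxDepth-++ ds (w ∷ ws) vs = trans (cong (srcDepth ds w ⊔_) (maxDepth-++ ds ws vs))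
    (sym (⊔-assoc (srcDepth ds w) _ _))

  -- Only values and depths of the old gates have to survive, since wires read nothing else of them.
  record _⊑_ {k k′} (C : Circuit m n k) (C′ : Circuit m n k′) : Set where
    field
      embed  : Fin k → Fin k′
      values : ∀ x j → lookup (evalAll C′ x) (embed j) ≡ lookup (evalAll C x) j
      levels : ∀ j → lookup (depths C′) (embed j) ≡ lookup (depths C) j

    embedSource : Source n k → Source n k′
    embedSource (input i) = input i
    embedSource one       = one
    embedSource (gate j)  = gate (embed j)

    wireSum-embed : ∀ x ws →
      wireSum x (evalAll C′ x) (map embedSource ws) ≡ wireSum x (evalAll C x) ws
    wireSum-embed x []             = refl
    wireSum-embed x (input i ∷ ws) = cong (bit (lookup x i) +_) (wireSum-embed x ws)
    wireSum-embed x (Source.one ∷ ws)     = cong suc (wireSum-embed x ws)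
    wireSum-embed x (gate j ∷ ws)  = cong₂ (λ b c → bit b + c) (values x j) (wireSum-embed x ws)

    maxDepth-embed : ∀ ws → maxDepth (depths C′) (map embedSource ws) ≡ maxDepth (depths C) ws
    maxDepth-embed []             = refl
    maxDepth-embed (input i ∷ ws) = maxDepth-embed ws
    maxDepth-embed (Source.one ∷ ws)     = maxDepth-embed ws
    maxDepth-embed (gate j ∷ ws)  = cong₂ _⊔_ (levels j) (maxDepth-embed ws)

  open _⊑_

  ⊑-refl : ∀ {k} {C : Circuit m n k} → C ⊑ C
  ⊑-refl = record { embed = λ j → j ; values = λ _ _ → refl ; levels = λ _ → refl }

  ⊑-trans : ∀ {k k′ k″} {C : Circuit m n k} {C′ : Circuit m n k′} {C″ : Circuit m n k″} →
    C ⊑ C′ → C′ ⊑ C″ → C ⊑ C″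
  ⊑-trans C⊑C′ C′⊑C″ = record
    { embed  = embed C′⊑C″ ∘ embed C⊑C′
    ; values = λ x j → trans (values C′⊑C″ x (embed C⊑C′ j)) (values C⊑C′ x j)
    ; levels = λ j → trans (levels C′⊑C″ (embed C⊑C′ j)) (levels C⊑C′ j)
    }

  ⊑-▷ : ∀ {k} (C : Circuit m n k) γ → C ⊑ (C ▷ γ)
  ⊑-▷ C (modGate _ _ _) = record
    { embed  = inject₁
    ; values = λ x → lookup-∷ʳ-inject₁ (evalAll C x) _
    ; levels = lookup-∷ʳ-inject₁ (depths C) _
    }

  -- The result is a list of wires, so that single formulas and lists of formulas compile alike, and
  -- variables and constants add no gate.
  record Extension {k} (C : Circuit m n k) (d s : ℕ) (F : Vec Bool n → ℕ) : Set where
    field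
      {gates}  : ℕ
      circuit  : Circuit m n gates
      extends  : C ⊑ circuit
      wires    : List (Source n gates)
      computes : ∀ x → wireSum x (evalAll circuit x) wires ≡ F x
      shallow  : maxDepth (depths circuit) wires ≤ d
      added    : gates ≡ s + k

  open Extension

  mutual
    compile : ∀ {d k} (φ : Formula m n d) (C : Circuit m n k) →
      Extension C d (size φ) (λ x → bit (evaluate φ x))
    compile one           C = record { extends = ⊑-refl ; wires = one ∷ [] ; computes = λ _ → refl
                                     ; shallow = z≤n ; added = refl }
    compile (var i)       C = record { extends = ⊑-refl ; wires = input i ∷ []
                                     ; computes = λ _ → +-identityʳ _ ; shallow = z≤n ; added = refl }
    compile {k = k} (mod q q∣m φs) C = record
      { extends  = ⊑-trans (extends E) (⊑-▷ (circuit E) γ)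
      ; wires    = gate (fromℕ (gates E)) ∷ []
      ; computes = λ x → trans (+-identityʳ _) (cong bit (trans
          (lookup-∷ʳ-fromℕ (evalAll (circuit E) x) _)
          (cong (λ c → does (q ∣? c)) (computes E x))))
      ; shallow  = ≤-trans (≤-reflexive (trans (⊔-identityʳ _) (lookup-∷ʳ-fromℕ (depths (circuit E)) _)))
          (s≤s (shallow E))
      ; added    = cong suc (added E)
      }
      where
      E = compiles φs C
      γ = modGate q q∣m (wires E)

    compiles : ∀ {d k} (φs : List (Formula m n d)) (C : Circuit m n k) →
      Extension C d (sizes φs) (count φs)
    compiles []               C = record { extends = ⊑-refl ; wires = [] ; computes = λ _ → refl
                                         ; shallow = z≤n ; added = refl }
    compiles {k = k} (φ ∷ φs) C = record
      { extends  = ⊑-trans (extends E₁) (extends E₂)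
      -- The wires for φ point into the circuit of `E₁` and are carried along its extension by φs.
      ; wires    = map (embedSource (extends E₂)) (wires E₁) ++ wires E₂
      ; computes = λ x → trans (wireSum-++ x _ (map (embedSource (extends E₂)) (wires E₁)) (wires E₂))
          (cong₂ _+_ (trans (wireSum-embed (extends E₂) x (wires E₁)) (computes E₁ x)) (computes E₂ x))
      ; shallow  = ≤-trans
          (≤-reflexive (maxDepth-++ _ (map (embedSource (extends E₂)) (wires E₁)) (wires E₂)))
          (⊔-lub (≤-trans (≤-reflexive (maxDepth-embed (extends E₂) (wires E₁))) (shallow E₁)) (shallow E₂))
      ; added    = trans (added E₂) (trans (cong (sizes φs +_) (added E₁)) (rearrange (sizes φs) (size φ) k))
      }
      where
      E₁ = compile φ C
      E₂ = compiles φs (circuit E₁)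
      rearrange : ∀ a b c → a + (b + c) ≡ b + a + c
      rearrange a b c = trans (sym (+-assoc a b c)) (cong (_+ c) (+-comm a b))

  formula-circuit : ∀ {d} q → q ∣ m → (φs : List (Formula m n d)) →
    ∃ λ k → Σ (Circuit m n (suc k)) λ C →
      (∀ x → output C x ≡ does (q ∣? count φs x)) × depth C ≤ suc d × k ≡ sizes φs
  formula-circuit q q∣m φs = gates E , circuit E ▷ modGate q q∣m (wires E) ,
    (λ x → trans (last-∷ʳ (evalAll (circuit E) x) _) (cong (λ c → does (q ∣? c)) (computes E x))) ,
    ≤-trans (≤-reflexive (last-∷ʳ (depths (circuit E)) _)) (s≤s (shallow E)) ,
    trans (added E) (+-identityʳ _)
    where
    E = compiles φs []

-- Choice of parameters

-- A representative for each number of ones up to n, by which a symmetric f becomes a function of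
-- that number.
firstOnes : ∀ n → ℕ → Vec Bool n
firstOnes zero    c       = []
firstOnes (suc n) zero    = false ∷ firstOnes n zero
firstOnes (suc n) (suc c) = true ∷ firstOnes n c

ones-firstOnes : ∀ {n c} → c ≤ n → ones (firstOnes n c) ≡ c
ones-firstOnes {zero}  z≤n       = refl
ones-firstOnes {suc n} z≤n       = ones-firstOnes {n} z≤n
ones-firstOnes {suc n} (s≤s c≤n) = cong suc (ones-firstOnes c≤n)

ones≤n : ∀ {n} (x : Vec Bool n) → ones x ≤ n
ones≤n []          = z≤n
ones≤n (true  ∷ x) = s≤s (ones≤n x)
ones≤n (false ∷ x) = m≤n⇒m≤1+n (ones≤n x)

does-∣-bit-not : ∀ {p a} → 1 < p → ∀ b → a ≈ bit (not b) [mod p ] → does (p ∣? a) ≡ b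
does-∣-bit-not {p} {a} 1<p true  a≈0 = dec-true (p ∣? a) (≈0⇒∣ a≈0)
does-∣-bit-not {p} {a} 1<p false a≈1 = dec-false (p ∣? a) λ p∣a →
  contradiction (∣⇒≤ (∣-resp-≈ a≈1 p∣a)) (<⇒≱ 1<p)

^-distribʳ-* : ∀ t a b → (a * b) ^ t ≡ a ^ t * b ^ t
^-distribʳ-* zero    a b = refl
^-distribʳ-* (suc t) a b = trans (cong (a * b *_) (^-distribʳ-* t a b)) (lemma a b (a ^ t) (b ^ t))
  where
  lemma : ∀ a b c d → a * b * (c * d) ≡ a * c * (b * d)
  lemma = solve-∀

-- By recursion on n, s increases only when s ^ t falls below the new n. Then suc s ≤ 2 * s loses at
-- most the factor 2 ^ t.
ceilingRoot : ∀ t → 0 < t → ∀ n → 0 < n → ∃ λ s → 1 ≤ s × n ≤ s ^ t × s ^ t ≤ 2 ^ t * n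
ceilingRoot t 0<t (suc zero) _ = 1 , ≤-refl , ≤-reflexive (sym (^-zeroˡ t)) ,
  ≤-trans (^-monoˡ-≤ t (s≤s z≤n)) (≤-reflexive (sym (*-identityʳ (2 ^ t))))
ceilingRoot t 0<t (suc (suc n)) _ = next (ceilingRoot t 0<t (suc n) z<s)
  where
  next : (∃ λ s → 1 ≤ s × suc n ≤ s ^ t × s ^ t ≤ 2 ^ t * suc n) →
    ∃ λ s → 1 ≤ s × suc (suc n) ≤ s ^ t × s ^ t ≤ 2 ^ t * suc (suc n)
  next (s , 1≤s , n≤ , ≤n) with suc (suc n) ≤? s ^ t
  ... | yes n< = s , 1≤s , n< , ≤-trans ≤n (*-monoʳ-≤ (2 ^ t) (n≤1+n (suc n)))
  ... | no  n≮ = suc s , s≤s z≤n , ≤-<-trans n≤ (^-monoˡ-< t (n<1+n s)) , (begin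
      suc s ^ t                ≤⟨ ^-monoˡ-≤ t (+-monoˡ-≤ s 1≤s) ⟩
      (s + s) ^ t              ≡⟨ cong (λ z → (s + z) ^ t) (+-identityʳ s) ⟨
      (2 * s) ^ t              ≡⟨ ^-distribʳ-* t 2 s ⟩
      2 ^ t * s ^ t            ≤⟨ *-monoʳ-≤ (2 ^ t) (<⇒≤ (≰⇒> n≮)) ⟩
      2 ^ t * suc (suc n)      ∎)
    where
    open ≤-Reasoning
    instance _ = >-nonZero 0<t

<2^[1+⌊log₂⌋] : ∀ n → n < 2 ^ suc ⌊log₂ n ⌋
<2^[1+⌊log₂⌋] n = ≰⇒> λ 2^≤n → <-irrefl refl (≤-trans
  (≤-reflexive (sym (⌊log₂[2^n]⌋≡n (suc ⌊log₂ n ⌋)))) (⌊log₂⌋-mono-≤ 2^≤n))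

⌊log₂⌋-≤-^ : ∀ {k n} e → k ≤ n ^ e → ⌊log₂ k ⌋ ≤ suc ⌊log₂ n ⌋ * e
⌊log₂⌋-≤-^ {k} {n} e k≤ = ≤-trans (⌊log₂⌋-mono-≤ (begin
    k                             ≤⟨ k≤ ⟩
    n ^ e                         ≤⟨ ^-monoˡ-≤ e (<⇒≤ (<2^[1+⌊log₂⌋] n)) ⟩
    (2 ^ suc ⌊log₂ n ⌋) ^ e       ≡⟨ ^-*-assoc 2 (suc ⌊log₂ n ⌋) e ⟩
    2 ^ (suc ⌊log₂ n ⌋ * e)       ∎))
  (≤-reflexive (⌊log₂[2^n]⌋≡n _))
  where open ≤-Reasoning

-- Here r ≥ 2 is essential: sums modulo p are formed of gates for a different prime of m.
otherPrime : ∀ {ps} → All Prime ps → Unique ps → 2 ≤ length ps →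
  ∀ p → ∃ λ q → Prime q × q ∣ product ps × p ≢ q
otherPrime {p₁ ∷ p₂ ∷ ps} (pp₁ ∷ pp₂ ∷ _) ((p₁≢p₂ ∷ _) ∷ _) _ p with p ≟ p₁
... | yes refl = p₂ , pp₂ , ∣n⇒∣m*n p₁ (m∣m*n (product ps)) , p₁≢p₂
... | no  p≢p₁ = p₁ , pp₁ , m∣m*n (p₂ * product ps) , p≢p₁
otherPrime {_ ∷ []} _ _ (s≤s ())
otherPrime {[]} _ _ ()

-- The output gate has modulus p and accepts when the count vanishes modulo p, so the negation of f
-- is what has to be counted.
CountMod⇒circuit : ∀ {m n p d S} {f : Vec Bool n → Bool} → Prime p → p ∣ m →
  CountMod m n p d S (λ x → bit (not (f x))) →
  ∃ λ k → Σ (Circuit m n (suc k)) λ C → Computes C f × depth C ≤ suc d × k ≤ S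
CountMod⇒circuit {f = f} pp p∣m (counting φs correct bounded) with formula-circuit _ p∣m φs
... | k , C , computes , shallow , k≡ = k , C ,
  (λ x → trans (computes x) (does-∣-bit-not (prime>1 pp) (f x) (correct x))) ,
  shallow , ≤-trans (≤-reflexive k≡) bounded

symmetric-circuit : ∀ {ps} → All Prime ps → Unique ps → 2 ≤ length ps → ∀ j n s →
  n ≤ s ^ (j + length ps) → s ^ (j + length ps) < n * n → 1 ≤ s →
  2 ≤ n → product ps ≤ n → length ps ≤ n →
  (f : Vec Bool n → Bool) → Symmetric f →
  ∃ λ k → Σ (Circuit (product ps) n (suc k)) λ C →
    Computes C f × depth C ≤ 3 + j × k ≤ (n * n) ^ (rate (product ps) j * s)
symmetric-circuit {ps} primes distinct 2≤r j n s n≤ <nn 1≤s 2≤n m≤n r≤n f sym-f =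
  CountMod⇒circuit pp p∣m (CountMod-resp (λ x → ≈-reflexive (h-onesAt x))
    (CountMod-onesAt j (allFin n) (≤-trans (≤-reflexive (length-tabulate {n = n} (λ i → i))) n≤) <nn pp p∣m h))
  where
  instance _ = >-nonZero (<-trans z<s 2≤n)

  m≤n⇒m≤n*n : ∀ {m} → m ≤ n → m ≤ n * n
  m≤n⇒m≤n*n m≤n = ≤-trans m≤n (m≤m*n n n)

  -- The base is n * n because s ^ (j + r) may exceed n, though it is assumed to stay below n * n.
  open Construction ps primes distinct (<-trans z<s 2≤r) (otherPrime primes distinct 2≤r)
    n s (n * n) 1≤s (m≤n⇒m≤n*n 2≤n) (m≤n⇒m≤n*n m≤n) (m≤n⇒m≤n*n r≤n)

  somePrime : ∃ λ q → Prime q × q ∣ product ps × 0 ≢ q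
  -- The number to avoid is arbitrary; the call serves to pick a prime factor of m.
  somePrime = otherPrime primes distinct 2≤r 0
  pp  = proj₁ (proj₂ somePrime)
  p∣m = proj₁ (proj₂ (proj₂ somePrime))

  h : ℕ → ℕ
  h c = bit (not (f (firstOnes n c)))

  h-onesAt : ∀ x → h (onesAt (allFin n) x) ≡ bit (not (f x))
  h-onesAt x = cong (bit ∘ not) (sym-f _ x (trans
    (cong (ones ∘ firstOnes n) (onesAt-allFin x)) (ones-firstOnes (ones≤n x))))

-- Raising to the power t expresses exp (Õ (n ^ (1/t))) without roots, as s ^ t is n up to a
-- constant factor. The additive ones are absorbed because both s and `⌊log₂ n ⌋` are at least 1.
log-size-bound : ∀ {k n} b s t → 2 ≤ n → 1 ≤ s → s ^ t ≤ 2 ^ t * n → k ≤ (n * n) ^ (b * s) →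
  ⌊log₂ suc k ⌋ ^ t ≤ (4 * suc b) ^ t * 2 ^ t * n * ⌊log₂ n ⌋ ^ t
log-size-bound {k} {n} b s t 2≤n 1≤s s^t≤ k≤ = begin
  ⌊log₂ suc k ⌋ ^ t
    ≤⟨ ^-monoˡ-≤ t (⌊log₂⌋-≤-^ {n = n} (2 * suc (b * s)) 1+k≤) ⟩
  (suc L * (2 * suc (b * s))) ^ t
    ≤⟨ ^-monoˡ-≤ t (*-mono-≤ 1+L≤ (*-monoʳ-≤ 2 (+-monoˡ-≤ (b * s) 1≤s))) ⟩
  ((L + L) * (2 * (suc b * s))) ^ t
    ≡⟨ cong (_^ t) (lemma₁ L (suc b) s) ⟩
  (4 * suc b * (s * L)) ^ t
    ≡⟨ ^-distribʳ-* t (4 * suc b) (s * L) ⟩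
  (4 * suc b) ^ t * (s * L) ^ t
    ≡⟨ cong ((4 * suc b) ^ t *_) (^-distribʳ-* t s L) ⟩
  (4 * suc b) ^ t * (s ^ t * L ^ t)
    ≤⟨ *-monoʳ-≤ ((4 * suc b) ^ t) (*-monoˡ-≤ (L ^ t) s^t≤) ⟩
  (4 * suc b) ^ t * (2 ^ t * n * L ^ t)
    ≡⟨ lemma₂ ((4 * suc b) ^ t) (2 ^ t) n (L ^ t) ⟩
  (4 * suc b) ^ t * 2 ^ t * n * L ^ t ∎
  where
  open ≤-Reasoning
  L = ⌊log₂ n ⌋
  2≤n*n : 2 ≤ n * n
  2≤n*n = ≤-trans (s≤s (s≤s z≤n)) (*-mono-≤ 2≤n 2≤n)
  1+L≤ : suc L ≤ L + L
  1+L≤ = +-monoˡ-≤ L (⌊log₂⌋-mono-≤ 2≤n)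
  1+k≤ : suc k ≤ n ^ (2 * suc (b * s))
  1+k≤ = ≤-trans (PowerBounds.successor 2≤n*n {i = b * s} k≤) (≤-reflexive (trans
    (cong (_^ suc (b * s)) (cong (n *_) (sym (*-identityʳ n)))) (^-*-assoc n 2 (suc (b * s)))))
  lemma₁ : ∀ L b s → (L + L) * (2 * (b * s)) ≡ 4 * b * (s * L)
  lemma₁ = solve-∀
  lemma₂ : ∀ a b n c → a * (b * n * c) ≡ a * b * n * c
  lemma₂ = solve-∀

theorem1p2 : (d r m : ℕ) → 3 ≤ d → 2 ≤ r → ProductOfDistinctPrimes r m →
    Σ ℕ λ C → Σ ℕ λ K → Σ ℕ λ N →
    (n : ℕ) → N ≤ n → (f : Vec Bool n → Bool) → Symmetric f →
    Σ ℕ λ k → Σ (Circuit m n (suc k)) λ circ →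
    Computes circ f × depth circ ≤ d ×
    ⌊log₂ (suc k) ⌋ ^ (r + d ∸ 3) ≤ C * n * ⌊log₂ n ⌋ ^ K
theorem1p2 (suc (suc (suc j))) r m (s≤s (s≤s (s≤s z≤n))) 2≤r (ps , refl , primes , distinct , refl) =
  C , t , N , circuit
  where
  -- There are 2 + j levels of counting below the output gate, so d = 3 + j and t = r + d - 3.
  t = j + r
  b = rate m j
  -- The first summand gives 2 ^ t * n < n * n, the second that 2, m and r are at most n.
  N = suc (2 ^ t) + (2 + (m + r))
  C = (4 * suc b) ^ t * 2 ^ t

  t≡r+d∸3 : t ≡ r + (3 + j) ∸ 3
  t≡r+d∸3 = sym (trans (cong (_∸ 3) (trans (+-comm r (3 + j)) (+-comm 3 t))) (m+n∸n≡m t 3))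

  module _ (n : ℕ) (N≤n : N ≤ n) (f : Vec Bool n → Bool) (sym-f : Symmetric f) where

    CircuitWith : (ℕ → Set) → Set
    CircuitWith P = Σ ℕ λ k → Σ (Circuit m n (suc k)) λ circ → Computes circ f × depth circ ≤ 3 + j × P k

    2+m+r≤n : 2 + (m + r) ≤ n
    2+m+r≤n = ≤-trans (m≤n+m _ (suc (2 ^ t))) N≤n
    2≤n : 2 ≤ n
    2≤n = ≤-trans (m≤m+n 2 (m + r)) 2+m+r≤n
    m+r≤n : m + r ≤ n
    m+r≤n = ≤-trans (m≤n+m (m + r) 2) 2+m+r≤n
    2^t<n : 2 ^ t < n
    2^t<n = ≤-trans (m≤m+n (suc (2 ^ t)) _) N≤n

    instance
      n≢0 : NonZero n
      n≢0 = >-nonZero (<-trans z<s 2≤n)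

    fromRoot : (∃ λ s → 1 ≤ s × n ≤ s ^ t × s ^ t ≤ 2 ^ t * n) →
      CircuitWith λ k → ⌊log₂ (suc k) ⌋ ^ (r + (3 + j) ∸ 3) ≤ C * n * ⌊log₂ n ⌋ ^ t
    fromRoot (s , 1≤s , n≤s^t , s^t≤) = bound (symmetric-circuit primes distinct 2≤r j n s n≤s^t
      (≤-<-trans s^t≤ (*-monoˡ-< n 2^t<n)) 1≤s 2≤n (m+n≤o⇒m≤o m m+r≤n) (m+n≤o⇒n≤o m m+r≤n) f sym-f)
      where
      bound : (CircuitWith λ k → k ≤ (n * n) ^ (b * s)) →
        CircuitWith λ k → ⌊log₂ (suc k) ⌋ ^ (r + (3 + j) ∸ 3) ≤ C * n * ⌊log₂ n ⌋ ^ t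
      bound (k , circ , computes , shallow , k≤) = k , circ , computes , shallow ,
        subst (λ e → ⌊log₂ (suc k) ⌋ ^ e ≤ C * n * ⌊log₂ n ⌋ ^ t) t≡r+d∸3
          (log-size-bound b s t 2≤n 1≤s s^t≤ k≤)

    circuit : CircuitWith λ k → ⌊log₂ (suc k) ⌋ ^ (r + (3 + j) ∸ 3) ≤ C * n * ⌊log₂ n ⌋ ^ t
    circuit = fromRoot (ceilingRoot t (≤-trans (<-trans z<s 2≤r) (m≤n+m r j)) n (<-trans z<s 2≤n))
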